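{- Let $q\ge 3$ be an integer and let $k_q=q-\frac{3}{2}+\frac{h_q}{2}$, where $h_q=1+\frac12+\frac13+\cdots+\frac1q$ is the $q$th harmonic number. Then there exists $n_0$ such that the following holds for every $n>n_0$: if $G$ is a balanced $q$-partite simple graph on $qn$ vertices and $\widetilde{\delta}(G)\ge \frac{k_q}{k_q+1}$, then $G$ has a $K_q$-factor.
   Context: A simple graph $F$ is $q$-partite if its vertex set can be partitioned into $q$ classes $A_1,\dots,A_q$, each an independent set; it is balanced if all classes have the same size (here each class has $n$ vertices). For such $F$ with given classes $A_1,\dots,A_q$, the proportional minimum degree is $\widetilde{\delta}(F)=\min_{1\le i\le q}\min_{v\in A_i}\min_{j\ne i}\frac{\deg(v,A_j)}{|A_j|}$, where $\deg(v,A_j)$ is the number of neighbours of $v$ in $A_j$. For a fixed graph $J$ on $q$ vertices, a $J$-factor of $F$ (when $q$ divides $|V(F)|$) is a subgraph of $F$ consisting of $|V(F)|/q$ vertex-disjoint copies of $J$; $K_q$ denotes the complete graph on $q$ vertices. -}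

module Defs where

open import Data.Nat as ℕ using (ℕ; zero; suc)
open import Data.Integer using (+_)
open import Data.Rational using (ℚ; _+_; _-_; _*_; _≤_; 0ℚ; 1ℚ; _/_)
open import Data.Fin using (Fin) renaming (zero to fz; suc to fs)
open import Data.Bool using (Bool; true; false)
open import Data.Product using (_×_; _,_; proj₁; proj₂)
open import Relation.Binary.PropositionalEquality using (_≡_; _≢_)

harmonic : ℕ → ℚ
harmonic zero    = 0ℚ
harmonic (suc m) = harmonic m + (+ 1 / suc m)

kq : ℕ → ℚ
kq q = (+ q / 1) - (+ 3 / 2) + harmonic q * (+ 1 / 2)

-- Vertices of a balanced q-partite graph with classes of size n:
-- vertex (i , v) is the v-th vertex of class A_i.
Vertex : ℕ → ℕ → Set
Vertex q n = Fin q × Fin n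

record BalancedPartiteGraph (q n : ℕ) : Set where
  field
    adj       : Vertex q n → Vertex q n → Bool
    symmetric : ∀ x y → adj x y ≡ adj y x
    -- each class A_i is an independent set (this also forbids loops)
    indepClasses : ∀ i (v w : Fin n) → adj (i , v) (i , w) ≡ false
open BalancedPartiteGraph public

countTrue : ∀ {n} → (Fin n → Bool) → ℕ
countTrue {zero}  f = 0
countTrue {suc n} f with f fz
... | true  = suc (countTrue (λ w → f (fs w)))
... | false = countTrue (λ w → f (fs w))

degTo : ∀ {q n} → BalancedPartiteGraph q n → Vertex q n → Fin q → ℕ
degTo G x j = countTrue (λ w → adj G x (j , w))

-- deg / |A_j| as a rational (|A_j| = n; the value for n = 0 is irrelevant)
ratio : ℕ → ℕ → ℚ
ratio d zero    = 0ℚ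
ratio d (suc m) = + d / suc m

-- δ̃(G) ≥ k/(k+1), written as: for every i, v ∈ A_i, j ≠ i,
-- k/(k+1) ≤ deg(v,A_j)/|A_j|, cross-multiplied by k+1 > 0:
-- k ≤ (k+1) * deg(v,A_j)/|A_j|.
PropMinDegAtLeast : ∀ {q n} → BalancedPartiteGraph q n → ℚ → Set
PropMinDegAtLeast {q} {n} G k =
  ∀ (i : Fin q) (v : Fin n) (j : Fin q) → j ≢ i →
    k ≤ (k + 1ℚ) * ratio (degTo G (i , v) j) n

-- A K_q-factor: n = qn/q copies of K_q, copy t having vertices f t r
-- (r : Fin q), the map (t , r) ↦ f t r injective (vertex-disjoint copies),
-- and distinct vertices in a copy adjacent.
record KFactor {q n : ℕ} (G : BalancedPartiteGraph q n) : Set where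
  field
    copy      : Fin n → Fin q → Vertex q n
    injective : ∀ t r t' r' → copy t r ≡ copy t' r' → (t ≡ t') × (r ≡ r')
    clique    : ∀ t r s → r ≢ s → adj G (copy t r) (copy t s) ≡ true

{-# OPTIONS --safe #-}
module Submission where

-- Every vertex has at most d non-neighbours in each other class, where (4q + 1) d ≤ 4n, since
-- k_q + 1 ≥ q + 1/4; only q d < n by a constant factor matters.
--
-- Heavy cliques.  If q h ≤ r bounds the non-degrees h in classes of size r, then for any vertex
-- weights some transversal clique has at least average weight: pick vertices greedily, heaviest
-- first, and average over the order in which the classes are served.
--
-- Nearly perfect tiling.  Remove cliques one by one.  For u(x, j) the number of uncovered
-- non-neighbours of x in class j, the k-th falling moments of all u(x, j) are summed to a potential;
-- a heavy clique for the weights given by its discrete derivative makes the potential decrease at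
-- least as fast as the falling factorial of the number r of uncovered vertices per class.  With k
-- linear in n this keeps q u(x, j) ≤ r until only a small proportion of the vertices is left.
--
-- Absorption.  Call a clique t good for (i, x, y) if t_j is adjacent to x for j ≠ i and t_i is
-- adjacent to y_j for j > i.  A positive proportion of all cliques is good for a given test, so a
-- greedy choice (weighting each test by 2 to the minus number of hits) yields a small family F
-- hitting every test linearly often.  An uncovered transversal z is absorbed by exchanging, for
-- i = q - 1, …, 0, the i-th coordinate of z with that of some t in F good for (i, z_i, z): t stays a
-- clique, and z becomes one.

open import Defs
open import Data.Bool as Bool using (Bool; true; false; not; _∧_)
open import Data.Bool.Properties using (∧-identityʳ)
open import Data.Empty using (⊥-elim)
open import Data.Fin as Fin using (Fin; toℕ; fromℕ<; zero; suc)
import Data.Fin.Properties as Fin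
open import Data.Integer as ℤ using () renaming (+_ to ⁺_)
import Data.Integer.Properties as ℤ
open import Data.List as List
  using (List; []; _∷_; _++_; length; map; concatMap; filter; downFrom; allFin; tabulate; cartesianProduct)
open import Data.List.Properties using (length-map; length-++; length-downFrom; length-tabulate; length-filter)
open import Data.List.Membership.Propositional using (_∈_; find)
open import Data.List.Membership.Propositional.Properties
open import Data.List.Relation.Binary.Permutation.Propositional as ↭
  using (_↭_; ↭-refl; ↭-sym; ↭-trans; prep; ↭⇒↭ₛ)
open import Data.List.Relation.Binary.Permutation.Propositional.Properties
  using (shift; ↭-length; ∈-resp-↭; All-resp-↭; ++⁺ʳ; ++-comm)
import Data.List.Relation.Binary.Permutation.Setoid.Properties as Permutationₛ
open import Data.List.Relation.Unary.All as All using (All; []; _∷_)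
open import Data.List.Relation.Unary.AllPairs using (AllPairs; []; _∷_)
open import Data.List.Relation.Unary.Any as Any using (here; there)
open import Data.List.Relation.Unary.Unique.Propositional using (Unique)
import Data.List.Relation.Unary.Unique.Propositional.Properties as Unique
open import Data.Nat as ℕ
open import Data.Nat.DivMod
open import Data.Nat.Properties as ℕ
open import Data.Nat.Tactic.RingSolver using (solve-∀)
open import Data.Product using (_×_; _,_; proj₁; proj₂; ∃-syntax)
open import Data.Rational as ℚ using (ℚ; 1ℚ; toℚᵘ)
import Data.Rational.Properties as ℚ
open import Data.Rational.Unnormalised as ℚᵘ using (mkℚᵘ; *≡*; *≤*)
import Data.Rational.Unnormalised.Properties as ℚᵘ
open import Data.Sum using (_⊎_; inj₁; inj₂)
open import Data.Vec as Vec using (Vec; []; _∷_; lookup; _[_]≔_)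
open import Data.Vec.Properties using (lookup∘update; lookup∘update′; lookup∘tabulate)
open import Function using (_∘_; id)
open import Relation.Binary using (DecidableEquality)
open import Relation.Binary.PropositionalEquality
open import Relation.Nullary
open import Relation.Nullary.Decidable using (dec-true; _→-dec_)
open import Relation.Nullary.Reflects using (ofʸ; ofⁿ)
open import Relation.Unary using (Decidable)

-- Finite sums

private variable
  A B : Set

∑ : List A → (A → ℕ) → ℕ
∑ []       f = 0
∑ (x ∷ xs) f = f x + ∑ xs f

⟦_⟧ : Bool → ℕ
⟦ true ⟧  = 1
⟦ false ⟧ = 0

∑-cong : ∀ (xs : List A) {f g} → (∀ x → f x ≡ g x) → ∑ xs f ≡ ∑ xs g
∑-cong []       eq = refl
∑-cong (x ∷ xs) eq = cong₂ _+_ (eq x) (∑-cong xs eq)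

∑-mono-∈ : ∀ (xs : List A) {f g} → (∀ {x} → x ∈ xs → f x ≤ g x) → ∑ xs f ≤ ∑ xs g
∑-mono-∈ []       le = z≤n
∑-mono-∈ (x ∷ xs) le = +-mono-≤ (le (here refl)) (∑-mono-∈ xs (le ∘ there))

∑-mono : ∀ (xs : List A) {f g} → (∀ x → f x ≤ g x) → ∑ xs f ≤ ∑ xs g
∑-mono xs le = ∑-mono-∈ xs (λ {x} _ → le x)

∑-distrib-+ : ∀ (xs : List A) f g → ∑ xs (λ x → f x + g x) ≡ ∑ xs f + ∑ xs g
∑-distrib-+ []       f g = refl
∑-distrib-+ (x ∷ xs) f g rewrite ∑-distrib-+ xs f g = interchange (f x) (g x) (∑ xs f) (∑ xs g)
  where
  interchange : ∀ a b c d → a + b + (c + d) ≡ a + c + (b + d)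
  interchange = solve-∀

∑-distribˡ-* : ∀ (xs : List A) c f → ∑ xs (λ x → c * f x) ≡ c * ∑ xs f
∑-distribˡ-* []       c f = sym (*-zeroʳ c)
∑-distribˡ-* (x ∷ xs) c f rewrite ∑-distribˡ-* xs c f = sym (*-distribˡ-+ c (f x) (∑ xs f))

∑-distribʳ-* : ∀ (xs : List A) f c → ∑ xs (λ x → f x * c) ≡ ∑ xs f * c
∑-distribʳ-* []       f c = refl
∑-distribʳ-* (x ∷ xs) f c rewrite ∑-distribʳ-* xs f c = sym (*-distribʳ-+ c (f x) (∑ xs f))

∑-const : ∀ (xs : List A) c → ∑ xs (λ _ → c) ≡ length xs * c
∑-const []       c = refl
∑-const (x ∷ xs) c = cong (c +_) (∑-const xs c)

∑-swap : ∀ (xs : List A) (ys : List B) (f : A → B → ℕ) →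
         ∑ xs (λ x → ∑ ys (f x)) ≡ ∑ ys (λ y → ∑ xs (λ x → f x y))
∑-swap []       ys f = sym (trans (∑-const ys 0) (*-zeroʳ (length ys)))
∑-swap (x ∷ xs) ys f rewrite ∑-swap xs ys f = sym (∑-distrib-+ ys (f x) _)

∑-++ : ∀ (xs ys : List A) f → ∑ (xs ++ ys) f ≡ ∑ xs f + ∑ ys f
∑-++ []       ys f = refl
∑-++ (x ∷ xs) ys f rewrite ∑-++ xs ys f = sym (+-assoc (f x) _ _)

∑-map : ∀ (h : A → B) xs f → ∑ (map h xs) f ≡ ∑ xs (f ∘ h)
∑-map h []       f = refl
∑-map h (x ∷ xs) f = cong (f (h x) +_) (∑-map h xs f)

∑-concatMap : ∀ (h : A → List B) xs f → ∑ (concatMap h xs) f ≡ ∑ xs (λ x → ∑ (h x) f)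
∑-concatMap h []       f = refl
∑-concatMap h (x ∷ xs) f = trans (∑-++ (h x) _ f) (cong (∑ (h x) f +_) (∑-concatMap h xs f))

∑-↭ : ∀ {xs ys : List A} f → xs ↭ ys → ∑ xs f ≡ ∑ ys f
∑-↭ f ↭.refl         = refl
∑-↭ f (↭.prep x p)   = cong (f x +_) (∑-↭ f p)
∑-↭ f (↭.swap {xs} x y p) rewrite ∑-↭ f p = rot (f x) (f y) _
  where
  rot : ∀ a b c → a + (b + c) ≡ b + (a + c)
  rot = solve-∀
∑-↭ f (↭.trans p q)  = trans (∑-↭ f p) (∑-↭ f q)

∈⇒≤∑ : ∀ {xs : List A} {x} f → x ∈ xs → f x ≤ ∑ xs f
∈⇒≤∑ f (here refl) = m≤m+n _ _
∈⇒≤∑ f (there x∈)  = m≤n⇒m≤o+n _ (∈⇒≤∑ f x∈)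

∑-filter : ∀ {P : A → Set} (P? : Decidable P) xs f →
           ∑ (filter P? xs) f ≡ ∑ xs (λ x → ⟦ does (P? x) ⟧ * f x)
∑-filter P? []       f = refl
∑-filter P? (x ∷ xs) f with does (P? x)
... | true  = cong₂ _+_ (sym (+-identityʳ (f x))) (∑-filter P? xs f)
... | false = ∑-filter P? xs f

-- Uniqueness makes the filter drop exactly one summand.
∑-remove : (_≟_ : DecidableEquality A) → ∀ {xs y} f → Unique xs → y ∈ xs →
           ∑ xs f ≡ f y + ∑ (filter (λ x → ¬? (x ≟ y)) xs) f
∑-remove _≟_ {x ∷ xs} {y} f (x∉ ∷ u) y∈ with x ≟ y
∑-remove _≟_ {x ∷ xs} {y} f (x∉ ∷ u) y∈ | yes refl = cong (f x +_) (unchanged xs x∉)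
  where
  unchanged : ∀ zs → All (x ≢_) zs → ∑ zs f ≡ ∑ (filter (λ z → ¬? (z ≟ x)) zs) f
  unchanged []       []       = refl
  unchanged (z ∷ zs) (p ∷ ps) with z ≟ x
  ... | yes z≡x = ⊥-elim (p (sym z≡x))
  ... | no  _   = cong (f z +_) (unchanged zs ps)
∑-remove _≟_ {x ∷ xs} {y} f (x∉ ∷ u) (here y≡x) | no x≢y = ⊥-elim (x≢y (sym y≡x))
∑-remove _≟_ {x ∷ xs} {y} f (x∉ ∷ u) (there y∈) | no x≢y
  rewrite ∑-remove _≟_ f u y∈ = rot (f x) (f y) _
  where
  rot : ∀ a b c → a + (b + c) ≡ b + (a + c)
  rot = solve-∀

-- Deleting a head with `g x < f x` keeps the inequality between the sums, so the search can go on
-- in the tail.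
averaging : ∀ {xs : List A} f g → 0 < length xs → ∑ xs f ≤ ∑ xs g → ∃[ x ] x ∈ xs × f x ≤ g x
averaging {xs = x ∷ xs} f g _ le with f x ≤? g x
... | yes fx≤gx = x , here refl , fx≤gx
averaging {xs = x ∷ []} f g _ le | no fx≰gx =
  ⊥-elim (fx≰gx (subst₂ _≤_ (+-identityʳ (f x)) (+-identityʳ (g x)) le))
averaging {xs = x ∷ y ∷ xs} f g _ le | no fx≰gx =
  let z , z∈ , fz≤gz = averaging {xs = y ∷ xs} f g (s≤s z≤n)
        (+-cancelˡ-≤ (g x) _ _ (≤-trans (+-monoˡ-≤ _ (<⇒≤ (≰⇒> fx≰gx))) le))
  in z , there z∈ , fz≤gz

positive-count : ∀ (xs : List A) (p : A → Bool) → 0 < ∑ xs (λ x → ⟦ p x ⟧) → ∃[ x ] x ∈ xs × p x ≡ true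
positive-count (x ∷ xs) p pos with p x in eq
... | true  = x , here refl , eq
... | false = let y , y∈ , py = positive-count xs p pos in y , there y∈ , py

count≤length : ∀ (xs : List A) (p : A → Bool) → ∑ xs (λ x → ⟦ p x ⟧) ≤ length xs
count≤length []       p = z≤n
count≤length (x ∷ xs) p with p x
... | true  = s≤s (count≤length xs p)
... | false = m≤n⇒m≤1+n (count≤length xs p)

-- Falling factorials and powers

fall : ℕ → ℕ → ℕ
fall u       zero    = 1
fall zero    (suc k) = 0
fall (suc u) (suc k) = suc u * fall u k

-- The exact discrete derivative in u. It is the reason why the potential is built from falling
-- factorials rather than powers.
fall-suc : ∀ u k → fall (suc u) (suc k) ≡ fall u (suc k) + suc k * fall u k
fall-suc zero    zero    = refl
fall-suc zero    (suc k) = sym (*-zeroʳ (suc (suc k)))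
fall-suc (suc u) zero    = cong suc (trans (*-identityʳ (suc u)) (sym (trans (+-comm _ 1) (cong suc (*-identityʳ u)))))
fall-suc (suc u) (suc k) = begin
  suc (suc u) * (suc u * fall u k)                             ≡⟨ h1 (suc u) (fall u k) ⟩
  suc u * (suc u * fall u k + fall u k)                           ≡⟨ cong (λ z → suc u * (z + fall u k)) (fall-suc u k) ⟩
  suc u * (fall u (suc k) + suc k * fall u k + fall u k)            ≡⟨ h2 (suc u) (fall u (suc k)) k (fall u k) ⟩
  suc u * fall u (suc k) + suc (suc k) * (suc u * fall u k)       ∎
  where
  open ≡-Reasoning
  h1 : ∀ v f → suc v * (v * f) ≡ v * (v * f + f)
  h1 = solve-∀
  h2 : ∀ v g k f → v * (g + suc k * f + f) ≡ v * g + suc (suc k) * (v * f)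
  h2 = solve-∀

fall-mono : ∀ {u v} k → u ≤ v → fall u k ≤ fall v k
fall-mono zero    le       = ≤-refl
fall-mono (suc k) z≤n      = z≤n
fall-mono (suc k) (s≤s le) = *-mono-≤ (s≤s le) (fall-mono k le)

fall≤^ : ∀ u k → fall u k ≤ u ^ k
fall≤^ u       zero    = ≤-refl
fall≤^ zero    (suc k) = z≤n
fall≤^ (suc u) (suc k) = *-monoʳ-≤ (suc u) (≤-trans (fall≤^ u k) (^-monoˡ-≤ k (n≤1+n u)))

^≤fall : ∀ v k → v ^ k ≤ fall (v + k) k
^≤fall v zero    = ≤-refl
^≤fall v (suc k) rewrite +-suc v k = *-mono-≤ (m≤n⇒m≤1+n (m≤m+n v k)) (^≤fall v k)

fall-pos : ∀ {u} k → k ≤ u → 0 < fall u k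
fall-pos zero    le       = s≤s z≤n
fall-pos (suc k) (s≤s {n = u} le) = *-mono-≤ {1} {suc u} (s≤s z≤n) (fall-pos k le)

-- The factors (d - i) / (r - i) do not exceed d / r; the offset e makes the induction go through.
fall-ratio-offset : ∀ e {d r} k → d ≤ r → fall d k * (e + r) ^ k ≤ (e + d) ^ k * fall r k
fall-ratio-offset e zero d≤r = ≤-refl
fall-ratio-offset e {zero} (suc k) d≤r = z≤n
fall-ratio-offset e {suc d} {suc r} (suc k) (s≤s d≤r) = begin
  suc d * fall d k * ((e + suc r) * (e + suc r) ^ k)
    ≡⟨ interchange (suc d) (fall d k) (e + suc r) _ ⟩
  suc d * (e + suc r) * (fall d k * (e + suc r) ^ k)
    ≤⟨ *-mono-≤ cross shifted ⟩
  (e + suc d) * suc r * ((e + suc d) ^ k * fall r k)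
    ≡⟨ interchange (e + suc d) (suc r) _ (fall r k) ⟩
  (e + suc d) * (e + suc d) ^ k * (suc r * fall r k) ∎
  where
  open ≤-Reasoning
  interchange : ∀ a b c e → a * b * (c * e) ≡ (a * c) * (b * e)
  interchange = solve-∀
  shifted : fall d k * (e + suc r) ^ k ≤ (e + suc d) ^ k * fall r k
  shifted rewrite +-suc e r | +-suc e d = fall-ratio-offset (suc e) k d≤r
  cross : suc d * (e + suc r) ≤ (e + suc d) * suc r
  cross = begin
    suc d * (e + suc r)       ≡⟨ *-distribˡ-+ (suc d) e (suc r) ⟩
    suc d * e + suc d * suc r ≤⟨ +-monoˡ-≤ _ (*-monoˡ-≤ e (s≤s d≤r)) ⟩
    suc r * e + suc d * suc r ≡⟨ cong (_+ suc d * suc r) (*-comm (suc r) e) ⟩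
    e * suc r + suc d * suc r ≡⟨ *-distribʳ-+ (suc r) e (suc d) ⟨
    (e + suc d) * suc r       ∎

fall-ratio : ∀ {d r} k → d ≤ r → fall d k * r ^ k ≤ d ^ k * fall r k
fall-ratio = fall-ratio-offset 0

-- Bernoulli's inequality (1 + 1/a)^j ≥ 1 + j/a, cleared of denominators.
bernoulli : ∀ a j → a ^ j * (a + j) ≤ a * suc a ^ j
bernoulli a zero    rewrite +-identityʳ a | *-identityʳ a = ≤-reflexive (+-identityʳ a)
bernoulli a (suc j) = begin
  a * a ^ j * (a + suc j)                     ≤⟨ m≤m+n _ (a ^ j * j) ⟩
  a * a ^ j * (a + suc j) + a ^ j * j         ≡⟨ expand a (a ^ j) j ⟩
  suc a * (a ^ j * (a + j))                   ≤⟨ *-monoʳ-≤ (suc a) (bernoulli a j) ⟩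
  suc a * (a * suc a ^ j)                     ≡⟨ rot (suc a) a (suc a ^ j) ⟩
  a * (suc a * suc a ^ j)                     ∎
  where
  open ≤-Reasoning
  expand : ∀ a p j → a * p * (a + suc j) + p * j ≡ suc a * (p * (a + j))
  expand = solve-∀
  rot : ∀ a b c → a * (b * c) ≡ b * (a * c)
  rot = solve-∀

2*a^a≤[1+a]^a : ∀ a .{{_ : NonZero a}} → 2 * a ^ a ≤ suc a ^ a
2*a^a≤[1+a]^a a = *-cancelˡ-≤ a (subst (_≤ a * suc a ^ a) (double a (a ^ a)) (bernoulli a a))
  where
  double : ∀ a p → p * (a + a) ≡ a * (2 * p)
  double = solve-∀

^-distribʳ-* : ∀ a b k → (a * b) ^ k ≡ a ^ k * b ^ k
^-distribʳ-* a b zero    = refl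
^-distribʳ-* a b (suc k) rewrite ^-distribʳ-* a b k = interchange a b (a ^ k) (b ^ k)
  where
  interchange : ∀ a b c e → a * b * (c * e) ≡ (a * c) * (b * e)
  interchange = solve-∀

-- The t-th power of (1 + 1/a)^a ≥ 2. Both greedy arguments use it to let an exponential gain beat a
-- polynomial loss.
2^t*a^[a*t]≤[1+a]^[a*t] : ∀ a t .{{_ : NonZero a}} → 2 ^ t * a ^ (a * t) ≤ suc a ^ (a * t)
2^t*a^[a*t]≤[1+a]^[a*t] a t = begin
  2 ^ t * a ^ (a * t)   ≡⟨ cong (2 ^ t *_) (^-*-assoc a a t) ⟨
  2 ^ t * (a ^ a) ^ t   ≡⟨ ^-distribʳ-* 2 (a ^ a) t ⟨
  (2 * a ^ a) ^ t       ≤⟨ ^-monoˡ-≤ t (2*a^a≤[1+a]^a a) ⟩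
  (suc a ^ a) ^ t       ≡⟨ ^-*-assoc (suc a) a t ⟩
  suc a ^ (a * t)       ∎
  where open ≤-Reasoning

-- From t to t + 1 the left side at most doubles. At t = 2c + 1 it lies below 2 (c + 1)^2, and c + 1
-- ≤ 2^c.
linear<exponential : ∀ c t → suc (c + c) ≤ t → c * t < 2 ^ t
linear<exponential c t le with ≤⇒≤′ le
... | le′ = go le′
  where
  c<2^c : ∀ c → c < 2 ^ c
  c<2^c zero    = s≤s z≤n
  c<2^c (suc c) = ≤-trans (s≤s (c<2^c c)) (≤-trans (+-monoˡ-≤ (2 ^ c) (m^n>0 2 c)) (+-monoʳ-≤ (2 ^ c) (m≤m+n _ 0)))
  go : ∀ {t} → suc (c + c) ≤′ t → c * t < 2 ^ t
  go ≤′-refl = begin-strict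
    c * suc (c + c)           ≤⟨ m≤m+n _ c ⟩
    c * suc (c + c) + c       <⟨ n<1+n _ ⟩
    suc (c * suc (c + c) + c) ≤⟨ m≤m+n _ (suc (c + c)) ⟩
    suc (c * suc (c + c) + c) + suc (c + c) ≡⟨ square c ⟩
    2 * (suc c * suc c)       ≤⟨ *-monoʳ-≤ 2 (*-mono-≤ (c<2^c c) (c<2^c c)) ⟩
    2 * (2 ^ c * 2 ^ c)       ≡⟨ cong (2 *_) (^-distribˡ-+-* 2 c c) ⟨
    2 ^ suc (c + c)           ∎
    where
    open ≤-Reasoning
    square : ∀ c → suc (c * suc (c + c) + c) + suc (c + c) ≡ 2 * (suc c * suc c)
    square = solve-∀
  go (≤′-step {t} le) = begin-strict
    c * suc t       ≡⟨ *-suc c t ⟩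
    c + c * t       ≤⟨ +-monoˡ-≤ (c * t) (m≤m*n c t {{>-nonZero (≤-trans (s≤s z≤n) (≤′⇒≤ le))}}) ⟩
    c * t + c * t   <⟨ +-mono-< (go le) (go le) ⟩
    2 ^ t + 2 ^ t   ≡⟨ cong (2 ^ t +_) (sym (+-identityʳ (2 ^ t))) ⟩
    2 ^ suc t       ∎
    where open ≤-Reasoning

-- Heavy cliques

∧-trueˡ : ∀ {x y} → x ∧ y ≡ true → x ≡ true
∧-trueˡ {true} _ = refl

∧-trueʳ : ∀ {x y} → x ∧ y ≡ true → y ≡ true
∧-trueʳ {true} eq = eq

∈⇒↭ : ∀ {x : A} {xs} → x ∈ xs → ∃[ ys ] xs ↭ x ∷ ys
∈⇒↭ {x = x} x∈ with ∈-∃++ x∈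
... | ys , zs , refl = ys ++ zs , shift x ys zs

-- The rank of an entry is the number of entries behind it.
rankSum : (A → ℕ → ℕ) → List A → ℕ
rankSum b []       = 0
rankSum b (j ∷ js) = b j (length js) + rankSum b js

-- With p the length of `js`, each element takes each rank equally often over all orders, so the
-- left side is p times the mean of `rankSum`.
Arrangement : (A → ℕ → ℕ) → ℕ → List A → Set
Arrangement b p js = ∃[ ks ] ks ↭ js × ∑ js (λ j → ∑ (downFrom p) (b j)) ≤ p * rankSum b ks

-- The element of highest rank is the one maximising p * b j p - S j.
arrangement-step : ∀ (b : A → ℕ → ℕ) p .{{_ : NonZero p}} js → length js ≡ suc p →
  (∀ ks → length ks ≡ p → Arrangement b p ks) → Arrangement b (suc p) js
arrangement-step b p js eq smaller = j ∷ ks , ↭-trans (prep j ks↭js′) (↭-sym js↭) , bound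
  where
  S = λ j → ∑ (downFrom p) (b j)
  -- `f j ≤ g j` says that p * b j p - S j is at least its mean over the `suc p` elements, with the
  -- subtractions moved across.
  f g : _ → ℕ
  f j = ∑ js (λ i → p * b i p) + suc p * S j
  g j = suc p * (p * b j p) + ∑ js S
  same : ∑ js f ≡ ∑ js g
  same = begin
    ∑ js f
      ≡⟨ ∑-distrib-+ js _ _ ⟩
    ∑ js (λ _ → ∑ js (λ i → p * b i p)) + ∑ js (λ j → suc p * S j)
      ≡⟨ cong₂ _+_ (∑-const js _) (∑-distribˡ-* js (suc p) S) ⟩
    length js * ∑ js (λ i → p * b i p) + suc p * ∑ js S
      ≡⟨ cong₂ (λ l l′ → l * ∑ js (λ i → p * b i p) + l′ * ∑ js S) eq (sym eq) ⟩
    suc p * ∑ js (λ i → p * b i p) + length js * ∑ js S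
      ≡⟨ cong₂ _+_ (∑-distribˡ-* js (suc p) _) (∑-const js _) ⟨
    ∑ js (λ j → suc p * (p * b j p)) + ∑ js (λ _ → ∑ js S)
      ≡⟨ ∑-distrib-+ js _ _ ⟨
    ∑ js g ∎
    where open ≡-Reasoning
  best = averaging {xs = js} f g (subst (0 <_) (sym eq) (s≤s z≤n)) (≤-reflexive same)
  j   = proj₁ best
  fg  = proj₂ (proj₂ best)
  js↭′ = ∈⇒↭ (proj₁ (proj₂ best))
  js′ = proj₁ js↭′
  js↭ = proj₂ js↭′
  len = suc-injective (trans (sym (↭-length js↭)) eq)
  IH  = smaller js′ len
  ks  = proj₁ IH
  ks↭js′ = proj₁ (proj₂ IH)
  lenks : length ks ≡ p
  lenks = trans (↭-length ks↭js′) len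
  bound : ∑ js (λ j → b j p + S j) ≤ suc p * (b j (length ks) + rankSum b ks)
  bound = *-cancelˡ-≤ p (+-cancelʳ-≤ (suc p * S j) _ _ (begin
    p * ∑ js (λ j → b j p + S j) + suc p * S j
      ≡⟨ cong (λ z → p * z + suc p * S j) (∑-distrib-+ js _ S) ⟩
    p * (∑ js (λ j → b j p) + ∑ js S) + suc p * S j
      ≡⟨ e1 p (∑ js (λ j → b j p)) (∑ js S) (suc p * S j) ⟩
    p * ∑ js (λ j → b j p) + suc p * S j + p * ∑ js S
      ≡⟨ cong (λ z → z + suc p * S j + p * ∑ js S) (∑-distribˡ-* js p _) ⟨
    f j + p * ∑ js S
      ≤⟨ +-monoˡ-≤ (p * ∑ js S) fg ⟩
    suc p * (p * b j p) + ∑ js S + p * ∑ js S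
      ≡⟨ e2 (suc p * (p * b j p)) p (∑ js S) ⟩
    suc p * (p * b j p) + suc p * ∑ js S
      ≡⟨ cong (λ z → suc p * (p * b j p) + suc p * z) (∑-↭ S js↭) ⟩
    suc p * (p * b j p) + suc p * (S j + ∑ js′ S)
      ≤⟨ +-monoʳ-≤ (suc p * (p * b j p)) (*-monoʳ-≤ (suc p) (+-monoʳ-≤ (S j) (proj₂ (proj₂ IH)))) ⟩
    suc p * (p * b j p) + suc p * (S j + p * rankSum b ks)
      ≡⟨ e3 (suc p) p (b j p) (S j) (rankSum b ks) ⟩
    p * (suc p * (b j p + rankSum b ks)) + suc p * S j
      ≡⟨ cong (λ z → p * (suc p * (b j z + rankSum b ks)) + suc p * S j) lenks ⟨
    p * (suc p * (b j (length ks) + rankSum b ks)) + suc p * S j ∎))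
    where
    open ≤-Reasoning
    e1 : ∀ p x y z → p * (x + y) + z ≡ p * x + z + p * y
    e1 = solve-∀
    e2 : ∀ x p y → x + y + p * y ≡ x + suc p * y
    e2 = solve-∀
    e3 : ∀ l p x y z → l * (p * x) + l * (y + p * z) ≡ p * (l * (x + z)) + l * y
    e3 = solve-∀

arrangement : ∀ (b : A → ℕ → ℕ) p js → length js ≡ p → Arrangement b p js
arrangement b zero          []       eq = [] , ↭-refl , z≤n
-- `arrangement-step` cancels the factor p, which would be 0 here; a single element has only rank 0.
arrangement b (suc zero)    (j ∷ []) eq =
  j ∷ [] , ↭-refl , ≤-reflexive (trans (+-identityʳ _) (sym (+-identityʳ _)))
arrangement b (suc p@(suc _)) js eq = arrangement-step b p js eq (arrangement b p)

-- Weight thresholds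

module _ (h : ℕ) where

  -- For h > 0 this is the minimum of p and ⌈N / h⌉: the number of ranks s at which N vertices
  -- outnumber the s * h that earlier choices may exclude.
  hits : ℕ → ℕ → ℕ
  hits p N = ∑ (downFrom p) (λ s → ⟦ s * h <ᵇ N ⟧)

  hits-bound : ∀ p N → hits p N ≡ p ⊎ N ≤ h * hits p N
  hits-bound zero    N = inj₁ refl
  hits-bound (suc p) N with p * h <ᵇ N | <ᵇ-reflects-< (p * h) N | hits-bound p N
  ... | true  | _        | inj₁ eq = inj₁ (cong suc eq)
  ... | true  | _        | inj₂ le = inj₂ (≤-trans le (*-monoʳ-≤ h (n≤1+n _)))
  ... | false | ofⁿ ph≮N | inj₁ eq = inj₂ (≤-trans (≮⇒≥ ph≮N) (≤-reflexive (trans (*-comm p h) (cong (h *_) (sym eq)))))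
  ... | false | _        | inj₂ le = inj₂ le

  -- Either every rank counts and N ≤ r suffices, or N ≤ h * hits and q * h ≤ r finishes. This
  -- trades a proportion of vertices for a proportion of ranks.
  hits-density : ∀ {q r N} → q * h ≤ r → N ≤ r → q * N ≤ r * hits q N
  hits-density {q} {r} {N} qh≤r N≤r with hits-bound q N
  ... | inj₁ eq = ≤-trans (*-monoʳ-≤ q N≤r) (≤-reflexive (trans (*-comm q r) (cong (r *_) (sym eq))))
  ... | inj₂ le = ≤-trans (*-monoʳ-≤ q le) (≤-trans (≤-reflexive (sym (*-assoc q h _))) (*-monoˡ-≤ _ qh≤r))

  module _ (xs : List A) (w : A → ℕ) where

    atLeast : ℕ → ℕ
    atLeast θ = ∑ xs (λ x → ⟦ θ ≤ᵇ w x ⟧)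

    -- The largest θ ≤ W such that more than s * h elements have weight at least θ.
    threshold : ℕ → ℕ → ℕ
    threshold s zero    = zero
    threshold s (suc W) with s * h <ᵇ atLeast (suc W)
    ... | true  = suc W
    ... | false = threshold s W

    threshold-reached : ∀ s W → s * h < length xs → s * h < atLeast (threshold s W)
    threshold-reached s zero    lt = subst (s * h <_)
      (sym (trans (∑-const xs 1) (*-identityʳ (length xs)))) lt
    threshold-reached s (suc W) lt with s * h <ᵇ atLeast (suc W) | <ᵇ-reflects-< (s * h) (atLeast (suc W))
    ... | true  | ofʸ p = p
    ... | false | _     = threshold-reached s W lt

    -- If the top level is exceeded, the threshold equals the number of levels, which bounds any
    -- count of them; otherwise the top level contributes nothing.
    threshold-large : ∀ s W → ∑ (downFrom W) (λ θ → ⟦ s * h <ᵇ atLeast (suc θ) ⟧) ≤ threshold s W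
    threshold-large s zero    = z≤n
    threshold-large s (suc W) with s * h <ᵇ atLeast (suc W)
    ... | true  = s≤s (≤-trans (count≤length (downFrom W) _) (≤-reflexive (length-downFrom W)))
    ... | false = threshold-large s W

    -- Layer-cake summation: split the weights into levels, apply `hits-density` on each level, and
    -- sum back over the ranks.
    threshold-sum : ∀ {q} W → q * h ≤ length xs → (∀ {x} → x ∈ xs → w x ≤ W) →
      q * ∑ xs w ≤ length xs * ∑ (downFrom q) (λ s → threshold s W)
    threshold-sum {q} W qh≤r w≤W = begin
      q * ∑ xs w
        ≤⟨ *-monoʳ-≤ q (∑-mono-∈ xs (λ x∈ → layers _ W (w≤W x∈))) ⟩
      q * ∑ xs (λ x → ∑ (downFrom W) (λ θ → ⟦ suc θ ≤ᵇ w x ⟧))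
        ≡⟨ cong (q *_) (∑-swap xs (downFrom W) _) ⟩
      q * ∑ (downFrom W) (λ θ → atLeast (suc θ))
        ≡⟨ ∑-distribˡ-* (downFrom W) q _ ⟨
      ∑ (downFrom W) (λ θ → q * atLeast (suc θ))
        ≤⟨ ∑-mono (downFrom W) (λ θ → hits-density {q} qh≤r (count≤length xs (λ x → suc θ ≤ᵇ w x))) ⟩
      ∑ (downFrom W) (λ θ → length xs * hits q (atLeast (suc θ)))
        ≡⟨ ∑-distribˡ-* (downFrom W) (length xs) _ ⟩
      length xs * ∑ (downFrom W) (λ θ → hits q (atLeast (suc θ)))
        ≡⟨ cong (length xs *_) (∑-swap (downFrom W) (downFrom q) _) ⟩
      length xs * ∑ (downFrom q) (λ s → ∑ (downFrom W) (λ θ → ⟦ s * h <ᵇ atLeast (suc θ) ⟧))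
        ≤⟨ *-monoʳ-≤ (length xs) (∑-mono (downFrom q) (λ s → threshold-large s W)) ⟩
      length xs * ∑ (downFrom q) (λ s → threshold s W) ∎
      where
      open ≤-Reasoning
      full : ∀ v W → W ≤ v → W ≤ ∑ (downFrom W) (λ θ → ⟦ suc θ ≤ᵇ v ⟧)
      full v zero    le = z≤n
      full v (suc W) le with suc W ≤ᵇ v | ≤ᵇ-reflects-≤ (suc W) v
      ... | true  | _      = s≤s (full v W (≤-trans (n≤1+n W) le))
      ... | false | ofⁿ ¬p = ⊥-elim (¬p le)
      layers : ∀ v W → v ≤ W → v ≤ ∑ (downFrom W) (λ θ → ⟦ suc θ ≤ᵇ v ⟧)
      layers v zero    le = le
      layers v (suc W) le with suc W ≤ᵇ v | ≤ᵇ-reflects-≤ (suc W) v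
      ... | true  | ofʸ p  = ≤-trans le (s≤s (full v W (≤-trans (n≤1+n W) p)))
      ... | false | ofⁿ ¬p = layers v W (≤-pred (≰⇒> ¬p))

module Graph {q n : ℕ} (G : BalancedPartiteGraph q n) where

  Transversal : Set
  Transversal = Vec (Fin n) q

  Clique : Transversal → Set
  Clique c = ∀ i j → i ≢ j → adj G (i , lookup c i) (j , lookup c j) ≡ true

  adjAll : List (Vertex q n) → Vertex q n → Bool
  adjAll []       y = true
  adjAll (x ∷ xs) y = adj G x y ∧ adjAll xs y

  adjAll⁻ : ∀ {xs x y} → adjAll xs y ≡ true → x ∈ xs → adj G x y ≡ true
  adjAll⁻ {z ∷ xs} {y = y} eq x∈ with adj G z y in e
  adjAll⁻ eq (here refl) | true = e
  adjAll⁻ eq (there x∈)  | true = adjAll⁻ eq x∈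

  nonNeighbours : Vertex q n → Fin q → List (Fin n) → ℕ
  nonNeighbours x j as = ∑ as (λ a → ⟦ not (adj G x (j , a)) ⟧)

  -- Union bound: each vertex of `xs` excludes at most h candidates. The predicate p later demands a
  -- heavy vertex.
  common-neighbours : ∀ {h j} as (p : Fin n → Bool) xs →
    (∀ x → j ≢ proj₁ x → nonNeighbours x j as ≤ h) → (∀ {x} → x ∈ xs → j ≢ proj₁ x) →
    ∑ as (λ a → ⟦ p a ⟧) ≤ ∑ as (λ a → ⟦ adjAll xs (j , a) ∧ p a ⟧) + length xs * h
  common-neighbours as p [] few diff = ≤-reflexive (sym (+-identityʳ _))
  common-neighbours {h} {j} as p (x ∷ xs) few diff = begin
    ∑ as (λ a → ⟦ p a ⟧)
      ≤⟨ common-neighbours as p xs few (diff ∘ there) ⟩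
    ∑ as (λ a → ⟦ adjAll xs (j , a) ∧ p a ⟧) + length xs * h
      ≤⟨ +-monoˡ-≤ _ (∑-mono as (λ a → split (adj G x (j , a)) (adjAll xs (j , a)) (p a))) ⟩
    ∑ as (λ a → ⟦ adjAll (x ∷ xs) (j , a) ∧ p a ⟧ + ⟦ not (adj G x (j , a)) ⟧) + length xs * h
      ≡⟨ cong (_+ length xs * h) (∑-distrib-+ as _ _) ⟩
    ∑ as (λ a → ⟦ adjAll (x ∷ xs) (j , a) ∧ p a ⟧) + nonNeighbours x j as + length xs * h
      ≤⟨ +-monoˡ-≤ (length xs * h) (+-monoʳ-≤ _ (few x (diff (here refl)))) ⟩
    ∑ as (λ a → ⟦ adjAll (x ∷ xs) (j , a) ∧ p a ⟧) + h + length xs * h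
      ≡⟨ +-assoc (∑ as (λ a → ⟦ adjAll (x ∷ xs) (j , a) ∧ p a ⟧)) h (length xs * h) ⟩
    ∑ as (λ a → ⟦ adjAll (x ∷ xs) (j , a) ∧ p a ⟧) + length (x ∷ xs) * h ∎
    where
    open ≤-Reasoning
    split : ∀ s t p → ⟦ t ∧ p ⟧ ≤ ⟦ (s ∧ t) ∧ p ⟧ + ⟦ not s ⟧
    split true  true  true  = s≤s z≤n
    split false true  true  = s≤s z≤n
    split s     false p     = z≤n
    split s     true  false = z≤n

  module HeavyClique (R : Fin q → List (Fin n)) (r h : ℕ)
    (size : ∀ j → length (R j) ≡ r)
    (few : ∀ x j → j ≢ proj₁ x → nonNeighbours x j (R j) ≤ h)
    (qh≤r : q * h ≤ r) (0<r : 0 < r) {{_ : NonZero q}}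
    (w : Fin q → Fin n → ℕ) where

    -- The total weight caps every single weight, so levels up to W capture all of them.
    W = ∑ (allFin q) (λ j → ∑ (R j) (w j))

    b : Fin q → ℕ → ℕ
    b j s = threshold h (R j) (w j) s W

    -- The list is served from its end, so the head j comes after s = `length js` classes. These
    -- exclude at most s * h vertices of `R j`, while more than s * h reach the threshold `b j s`.
    greedy : ∀ (js : List (Fin q)) → Unique js → length js ≤ q →
      ∃[ c ] (∀ {j} → j ∈ js → lookup c j ∈ R j)
           × (∀ {i j} → i ∈ js → j ∈ js → i ≢ j → adj G (i , lookup c i) (j , lookup c j) ≡ true)
           × rankSum b js ≤ ∑ js (λ j → w j (lookup c j))
    -- Placeholders: an entry becomes meaningful once its class is served.
    greedy [] u len = Vec.tabulate (λ j → first (R j) (subst (0 <_) (sym (size j)) 0<r)) , (λ ()) , (λ ()) , z≤n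
      where
      first : (as : List (Fin n)) → 0 < length as → Fin n
      first (a ∷ _) _ = a
    greedy (j ∷ js) (j∉ ∷ u) len = c′ , inside , adjacent , weight
      where
      IH = greedy js u (≤-trans (n≤1+n _) len)
      c  = proj₁ IH
      xs : List (Vertex q n)
      xs = map (λ k → k , lookup c k) js
      s = length js
      js-outside : ∀ {x} → x ∈ xs → j ≢ proj₁ x
      js-outside x∈ j≡ with ∈-map⁻ _ x∈
      ... | k , k∈ , refl = All.lookup j∉ k∈ j≡
      sh<r : s * h < r
      sh<r = multiple< h qh≤r
        where
        -- For h = 0 strictness comes from 0 < r, otherwise from s < q.
        multiple< : ∀ h → q * h ≤ r → s * h < r
        multiple< zero     _    = subst (_< r) (sym (*-zeroʳ s)) 0<r
        multiple< (suc h′) qh≤r = <-≤-trans (*-monoˡ-< (suc h′) len) qh≤r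
      heavy : 0 < ∑ (R j) (λ a → ⟦ adjAll xs (j , a) ∧ (b j s ≤ᵇ w j a) ⟧)
      heavy = +-cancelʳ-< (s * h) _ _ (begin-strict
        s * h <⟨ threshold-reached h (R j) (w j) s W (subst (s * h <_) (sym (size j)) sh<r) ⟩
        ∑ (R j) (λ a → ⟦ b j s ≤ᵇ w j a ⟧)
          ≤⟨ common-neighbours (R j) (λ a → b j s ≤ᵇ w j a) xs (λ x → few x j) js-outside ⟩
        ∑ (R j) (λ a → ⟦ adjAll xs (j , a) ∧ (b j s ≤ᵇ w j a) ⟧) + length xs * h
          ≡⟨ cong (λ l → ∑ (R j) (λ a → ⟦ adjAll xs (j , a) ∧ (b j s ≤ᵇ w j a) ⟧) + l * h) (length-map _ js) ⟩
        ∑ (R j) (λ a → ⟦ adjAll xs (j , a) ∧ (b j s ≤ᵇ w j a) ⟧) + s * h ∎)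
        where open ≤-Reasoning
      pick = positive-count (R j) (λ a → adjAll xs (j , a) ∧ (b j s ≤ᵇ w j a)) heavy
      a = proj₁ pick
      c′ = c [ j ]≔ a
      at-j : lookup c′ j ≡ a
      at-j = lookup∘update j c a
      elsewhere : ∀ {k} → k ∈ js → lookup c′ k ≡ lookup c k
      elsewhere k∈ = lookup∘update′ (λ k≡j → All.lookup j∉ k∈ (sym k≡j)) c a
      inside : ∀ {k} → k ∈ j ∷ js → lookup c′ k ∈ R k
      inside (here refl) = subst (_∈ R j) (sym at-j) (proj₁ (proj₂ pick))
      inside (there k∈)  = subst (_∈ R _) (sym (elsewhere k∈)) (proj₁ (proj₂ IH) k∈)
      old-new : ∀ {k} → k ∈ js → adj G (k , lookup c′ k) (j , lookup c′ j) ≡ true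
      old-new k∈ rewrite at-j | elsewhere k∈ =
        adjAll⁻ {xs} (∧-trueˡ (proj₂ (proj₂ pick))) (∈-map⁺ (λ k → k , lookup c k) k∈)
      adjacent : ∀ {i k} → i ∈ j ∷ js → k ∈ j ∷ js → i ≢ k → adj G (i , lookup c′ i) (k , lookup c′ k) ≡ true
      adjacent (here refl) (here refl) i≢k = ⊥-elim (i≢k refl)
      adjacent (here refl) (there k∈)  i≢k = trans (symmetric G _ _) (old-new k∈)
      adjacent (there i∈)  (here refl) i≢k = old-new i∈
      adjacent (there i∈)  (there k∈)  i≢k rewrite elsewhere i∈ | elsewhere k∈ =
        proj₁ (proj₂ (proj₂ IH)) i∈ k∈ i≢k
      weight : rankSum b (j ∷ js) ≤ ∑ (j ∷ js) (λ j → w j (lookup c′ j))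
      weight = +-mono-≤
        (subst (λ z → b j s ≤ w j z) (sym at-j) (≤ᵇ⇒≤ _ _ (subst Bool.T (sym (∧-trueʳ {adjAll xs (j , a)} (proj₂ (proj₂ pick)))) _)))
        (≤-trans (proj₂ (proj₂ (proj₂ IH)))
          (∑-mono-∈ js (λ k∈ → ≤-reflexive (cong (w _) (sym (elsewhere k∈))))))

    -- In each class the mean threshold over the ranks is at least the mean weight. `arrangement`
    -- realises the average by one order of the classes, and `greedy` collects its rank sum.
    heavyClique : ∃[ c ] Clique c × (∀ j → lookup c j ∈ R j)
      × ∑ (allFin q) (λ j → ∑ (R j) (w j)) ≤ r * ∑ (allFin q) (λ j → w j (lookup c j))
    heavyClique with arrangement b q (allFin q) (length-tabulate _)
    ... | js , js↭ , sum≤ with greedy js unique (≤-reflexive (trans (↭-length js↭) (length-tabulate _)))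
      where
      unique : Unique js
      unique = Permutationₛ.Unique-resp-↭ (setoid _) (↭⇒↭ₛ (↭-sym js↭)) (Unique.allFin⁺ q)
    ... | c , inside , adjacent , weight =
      c , (λ i j → adjacent (mem i) (mem j)) , (λ j → inside (mem j)) , bound
      where
      mem : ∀ j → j ∈ js
      mem j = ∈-resp-↭ (↭-sym js↭) (∈-allFin j)
      open ≤-Reasoning
      bound : W ≤ r * ∑ (allFin q) (λ j → w j (lookup c j))
      bound = *-cancelˡ-≤ q (begin
        q * W
          ≡⟨ ∑-distribˡ-* (allFin q) q _ ⟨
        ∑ (allFin q) (λ j → q * ∑ (R j) (w j))
          ≤⟨ ∑-mono (allFin q) (λ j → ≤-trans
               (threshold-sum h (R j) (w j) {q} W (subst (q * h ≤_) (sym (size j)) qh≤r)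
                 (λ {a} a∈ → ≤-trans (∈⇒≤∑ (w j) a∈) (∈⇒≤∑ (λ j → ∑ (R j) (w j)) (∈-allFin j))))
               (≤-reflexive (cong (_* ∑ (downFrom q) (b j)) (size j)))) ⟩
        ∑ (allFin q) (λ j → r * ∑ (downFrom q) (b j))
          ≡⟨ ∑-distribˡ-* (allFin q) r _ ⟩
        r * ∑ (allFin q) (λ j → ∑ (downFrom q) (b j))
          ≤⟨ *-monoʳ-≤ r sum≤ ⟩
        r * (q * rankSum b js)
          ≤⟨ *-monoʳ-≤ r (*-monoʳ-≤ q weight) ⟩
        r * (q * ∑ js (λ j → w j (lookup c j)))
          ≡⟨ cong (λ z → r * (q * z)) (∑-↭ _ js↭) ⟩
        r * (q * ∑ (allFin q) (λ j → w j (lookup c j)))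
          ≡⟨ rot r q _ ⟩
        q * (r * ∑ (allFin q) (λ j → w j (lookup c j))) ∎)
        where
        rot : ∀ a b c → a * (b * c) ≡ b * (a * c)
        rot = solve-∀

-- Partial tilings and the potential

length-× : ∀ {A B : Set} (xs : List A) (ys : List B) → length (cartesianProduct xs ys) ≡ length xs * length ys
length-× []       ys = refl
length-× (x ∷ xs) ys = trans (length-++ (map (x ,_) ys)) (cong₂ _+_ (length-map _ ys) (length-× xs ys))

length≡∑1 : ∀ {A : Set} (xs : List A) → length xs ≡ ∑ xs (λ _ → 1)
length≡∑1 xs = sym (trans (∑-const xs 1) (*-identityʳ (length xs)))

length-allFin : ∀ m → length (allFin m) ≡ m
length-allFin m = length-tabulate {n = m} (λ i → i)

module Tiling {q n : ℕ} (G : BalancedPartiteGraph q n) where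

  open Graph G public

  Disjoint : Transversal → Transversal → Set
  Disjoint c d = ∀ j → lookup c j ≢ lookup d j

  free : List Transversal → Fin q → List (Fin n)
  free []      j = allFin n
  free (c ∷ T) j = filter (λ a → ¬? (a Fin.≟ lookup c j)) (free T j)

  free-unique : ∀ T j → Unique (free T j)
  free-unique []      j = Unique.allFin⁺ n
  free-unique (c ∷ T) j = Unique.filter⁺ _ (free-unique T j)

  ∈-free⁻ : ∀ {T j a c} → a ∈ free T j → c ∈ T → lookup c j ≢ a
  ∈-free⁻ {c ∷ T} {j} a∈ (here refl) eq = proj₂ (∈-filter⁻ (λ a → ¬? (a Fin.≟ lookup c j)) {xs = free T j} a∈) (sym eq)
  ∈-free⁻ {c ∷ T} {j} a∈ (there d∈)  eq = ∈-free⁻ {T} (proj₁ (∈-filter⁻ (λ a → ¬? (a Fin.≟ lookup c j)) {xs = free T j} a∈)) d∈ eq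

  ∈-free⁺ : ∀ T {j a} → (∀ {c} → c ∈ T → lookup c j ≢ a) → a ∈ free T j
  ∈-free⁺ []      {a = a} av = ∈-allFin a
  ∈-free⁺ (c ∷ T) av = ∈-filter⁺ _ (∈-free⁺ T (av ∘ there)) (λ eq → av (here refl) (sym eq))

  fresh⇒free : ∀ {c T} → All (Disjoint c) T → ∀ j → lookup c j ∈ free T j
  fresh⇒free {T = T} dis j = ∈-free⁺ T (λ d∈ eq → All.lookup dis d∈ j (sym eq))

  free⇒fresh : ∀ {c T} → (∀ j → lookup c j ∈ free T j) → All (Disjoint c) T
  free⇒fresh av = All.tabulate (λ d∈ j eq → ∈-free⁻ (av j) d∈ (sym eq))

  ∑-free : ∀ c T j f → All (Disjoint c) T → ∑ (free T j) f ≡ f (lookup c j) + ∑ (free (c ∷ T) j) f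
  ∑-free c T j f dis = ∑-remove Fin._≟_ f (free-unique T j) (fresh⇒free {c} dis j)

  length-free : ∀ T j → AllPairs Disjoint T → length T + length (free T j) ≡ n
  length-free []      j _ = length-allFin n
  length-free (c ∷ T) j (dis ∷ ap) = begin
    suc (length T + length (free (c ∷ T) j))           ≡⟨ +-suc _ _ ⟨
    length T + suc (length (free (c ∷ T) j))           ≡⟨ cong (λ z → length T + suc z) (length≡∑1 (free (c ∷ T) j)) ⟩
    length T + (1 + ∑ (free (c ∷ T) j) (λ _ → 1))      ≡⟨ cong (length T +_) (∑-free c T j (λ _ → 1) dis) ⟨
    length T + ∑ (free T j) (λ _ → 1)                  ≡⟨ cong (length T +_) (length≡∑1 (free T j)) ⟨
    length T + length (free T j)                       ≡⟨ length-free T j ap ⟩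
    n                                                  ∎
    where open ≡-Reasoning

  vertices : List (Vertex q n)
  vertices = cartesianProduct (allFin q) (allFin n)

  outside : Fin q → List (Vertex q n)
  outside j = filter (λ x → ¬? (j Fin.≟ proj₁ x)) vertices

  length-outside : ∀ j → length (outside j) ≤ q * n
  length-outside j = ≤-trans (length-filter _ vertices)
    (≤-reflexive (trans (length-× (allFin q) (allFin n)) (cong₂ _*_ (length-allFin q) (length-allFin n))))

  ∈-outside : ∀ {x j} → j ≢ proj₁ x → x ∈ outside j
  ∈-outside {x} ≢ = ∈-filter⁺ _ (∈-cartesianProduct⁺ (∈-allFin (proj₁ x)) (∈-allFin (proj₂ x))) ≢

  ∈-outside⁻ : ∀ {x j} → x ∈ outside j → j ≢ proj₁ x
  ∈-outside⁻ {x} {j} x∈ = proj₂ (∈-filter⁻ (λ x → ¬? (j Fin.≟ proj₁ x)) {xs = vertices} x∈)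

  module Potential (κ : ℕ) where

    k : ℕ
    k = suc κ

    u : List Transversal → Vertex q n → Fin q → ℕ
    u T x j = nonNeighbours x j (free T j)

    -- Removing a clique of average weight multiplies Φ by at most (r - k) / r, exactly the factor
    -- between fall r k and fall (r - 1) k.
    Φ : List Transversal → ℕ
    Φ T = ∑ (allFin q) (λ j → ∑ (outside j) (λ x → fall (u T x j) k))

    -- Up to the factor k, the drop of `Φ` when a is covered: each non-neighbour x of a loses one
    -- from `u T x j`.
    weight : List Transversal → Fin q → Fin n → ℕ
    weight T j a = ∑ (outside j) (λ x → ⟦ not (adj G x (j , a)) ⟧ * fall (u T x j ∸ 1) κ)

    -- Double counting: x is charged once by each of its u uncovered non-neighbours, and u * fall (u
    -- - 1) κ is `fall u k`.
    weight-total : ∀ T → ∑ (allFin q) (λ j → ∑ (free T j) (weight T j)) ≡ Φ T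
    weight-total T = ∑-cong (allFin q) (λ j → begin
      ∑ (free T j) (weight T j)
        ≡⟨ ∑-swap (free T j) (outside j) _ ⟩
      ∑ (outside j) (λ x → ∑ (free T j) (λ a → ⟦ not (adj G x (j , a)) ⟧ * fall (u T x j ∸ 1) κ))
        ≡⟨ ∑-cong (outside j) (λ x → trans (∑-distribʳ-* (free T j) _ (fall (u T x j ∸ 1) κ)) (absorb (u T x j))) ⟩
      ∑ (outside j) (λ x → fall (u T x j) k) ∎)
      where
      open ≡-Reasoning
      absorb : ∀ u → u * fall (u ∸ 1) κ ≡ fall u k
      absorb zero    = refl
      absorb (suc u) = refl

    Φ-remove : ∀ c T → All (Disjoint c) T → Φ T ≡ Φ (c ∷ T) + k * ∑ (allFin q) (λ j → weight T j (lookup c j))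
    Φ-remove c T dis = begin
      Φ T
        ≡⟨ ∑-cong (allFin q) (λ j → ∑-cong (outside j) (λ x → drop x j)) ⟩
      ∑ (allFin q) (λ j → ∑ (outside j) (λ x → fall (u (c ∷ T) x j) k + k * gain x j))
        ≡⟨ ∑-cong (allFin q) (λ j → trans (∑-distrib-+ (outside j) _ _)
             (cong (∑ (outside j) (λ x → fall (u (c ∷ T) x j) k) +_) (∑-distribˡ-* (outside j) k _))) ⟩
      ∑ (allFin q) (λ j → ∑ (outside j) (λ x → fall (u (c ∷ T) x j) k) + k * weight T j (lookup c j))
        ≡⟨ trans (∑-distrib-+ (allFin q) _ _) (cong (Φ (c ∷ T) +_) (∑-distribˡ-* (allFin q) k _)) ⟩
      Φ (c ∷ T) + k * ∑ (allFin q) (λ j → weight T j (lookup c j)) ∎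
      where
      open ≡-Reasoning
      gain : Vertex q n → Fin q → ℕ
      gain x j = ⟦ not (adj G x (j , lookup c j)) ⟧ * fall (u T x j ∸ 1) κ
      hit : ∀ b v → fall (⟦ b ⟧ + v) k ≡ fall v k + k * (⟦ b ⟧ * fall (⟦ b ⟧ + v ∸ 1) κ)
      hit true  v = trans (fall-suc v κ) (cong (λ z → fall v k + k * z) (sym (+-identityʳ (fall v κ))))
      hit false v = sym (trans (cong (fall v k +_) (*-zeroʳ k)) (+-identityʳ _))
      drop : ∀ x j → fall (u T x j) k ≡ fall (u (c ∷ T) x j) k + k * gain x j
      drop x j rewrite ∑-free c T j (λ a → ⟦ not (adj G x (j , a)) ⟧) dis = hit (not (adj G x (j , lookup c j))) (u (c ∷ T) x j)

    Φ-bound : ∀ T d → (∀ x j → j ≢ proj₁ x → u T x j ≤ d) → Φ T ≤ q * (q * n) * fall d k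
    Φ-bound T d le = begin
      Φ T ≤⟨ ∑-mono (allFin q) (λ j → ∑-mono-∈ (outside j) (λ x∈ → fall-mono k (le _ j (∈-outside⁻ x∈)))) ⟩
      ∑ (allFin q) (λ j → ∑ (outside j) (λ _ → fall d k))
        ≤⟨ ∑-mono (allFin q) (λ j → ≤-trans (≤-reflexive (∑-const (outside j) (fall d k))) (*-monoˡ-≤ (fall d k) (length-outside j))) ⟩
      ∑ (allFin q) (λ _ → q * n * fall d k) ≡⟨ ∑-const (allFin q) _ ⟩
      length (allFin q) * (q * n * fall d k) ≡⟨ cong (_* (q * n * fall d k)) (length-allFin q) ⟩
      q * (q * n * fall d k) ≡⟨ *-assoc q (q * n) _ ⟨
      q * (q * n) * fall d k ∎
      where open ≤-Reasoning

    module Extend {{_ : NonZero q}} (F : List Transversal) (ℓ r₀ C : ℕ) (k≤ℓ : k ≤ ℓ)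
      (sparse : ∀ {v r} → ℓ ≤ r → fall v k * fall r₀ k ≤ C * fall r k → q * v ≤ r) where

      -- The invariant bounds Φ T / fall r k by C / fall r₀ k, with r = g + ℓ vertices uncovered per
      -- class. Since `Φ` dominates each of its summands, `sparse` yields the degree condition for
      -- the next heavy clique.
      extend : ∀ g P → AllPairs Disjoint (P ++ F) → All Clique (P ++ F) →
        length (P ++ F) + (g + ℓ) ≡ n → Φ (P ++ F) * fall r₀ k ≤ C * fall (g + ℓ) k →
        ∃[ P′ ] AllPairs Disjoint (P′ ++ F) × All Clique (P′ ++ F) × length (P′ ++ F) + ℓ ≡ n
      extend zero    P ap cl len inv = P , ap , cl , len
      extend (suc g) P ap cl len inv =
        extend g (c ∷ P) (dis ∷ ap) (proj₁ (proj₂ best) ∷ cl) (trans (sym (+-suc _ _)) len) inv′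
        where
        T = P ++ F
        r′ = g + ℓ
        r = suc r′
        few : ∀ x j → j ≢ proj₁ x → u T x j ≤ r / q
        few x j j≢ = subst (_≤ r / q) (trans (/-congˡ {o = q} (*-comm q _)) (m*n/n≡m (u T x j) q))
          (/-monoˡ-≤ q (sparse {u T x j} {r} (≤-trans (m≤n+m ℓ g) (n≤1+n _)) (≤-trans (*-monoˡ-≤ (fall r₀ k)
            (≤-trans (∈⇒≤∑ (λ x → fall (u T x j) k) (∈-outside j≢))
                     (∈⇒≤∑ (λ j → ∑ (outside j) (λ x → fall (u T x j) k)) (∈-allFin j)))) inv)))
        size : ∀ j → length (free T j) ≡ r
        size j = +-cancelˡ-≡ (length T) _ _ (trans (length-free T j ap) (sym len))
        open HeavyClique (free T) r (r / q) size few
          (subst (_≤ r) (*-comm (r / q) q) (m/n*n≤m r q)) (s≤s z≤n) (weight T)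
        best = heavyClique
        c = proj₁ best
        dis : All (Disjoint c) T
        dis = free⇒fresh {c} (proj₁ (proj₂ (proj₂ best)))
        Ω = ∑ (allFin q) (λ j → weight T j (lookup c j))
        Φ≤ : Φ T ≤ r * Ω
        Φ≤ = subst (_≤ r * Ω) (weight-total T) (proj₂ (proj₂ (proj₂ best)))
        e = r ∸ k
        r≡ : k + e ≡ r
        r≡ = m+[n∸m]≡n (≤-trans k≤ℓ (≤-trans (m≤n+m ℓ g) (n≤1+n _)))
        -- Φ T ≤ r * Ω, and the removal lowers `Φ` by k * Ω, that is, by at least the fraction k /
        -- r.
        decrease : r * Φ (c ∷ T) ≤ e * Φ T
        decrease = +-cancelʳ-≤ (k * Φ T) _ _ (begin
          r * Φ (c ∷ T) + k * Φ T         ≤⟨ +-monoʳ-≤ (r * Φ (c ∷ T)) (*-monoʳ-≤ k Φ≤) ⟩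
          r * Φ (c ∷ T) + k * (r * Ω)     ≡⟨ a1 r (Φ (c ∷ T)) k Ω ⟩
          r * (Φ (c ∷ T) + k * Ω)         ≡⟨ cong (r *_) (Φ-remove c T dis) ⟨
          r * Φ T                         ≡⟨ cong (_* Φ T) r≡ ⟨
          (k + e) * Φ T                   ≡⟨ trans (*-distribʳ-+ (Φ T) k e) (+-comm (k * Φ T) _) ⟩
          e * Φ T + k * Φ T               ∎)
          where
          open ≤-Reasoning
          a1 : ∀ r p k o → r * p + k * (r * o) ≡ r * (p + k * o)
          a1 = solve-∀
        -- `fall` shrinks by exactly the same factor e / r, so the invariant survives.
        fall-decrease : e * fall r k ≡ r * fall r′ k
        fall-decrease = +-cancelʳ-≡ (k * fall r k) _ _ (begin
          e * fall r k + k * fall r k ≡⟨ trans (+-comm (e * fall r k) _) (sym (*-distribʳ-+ (fall r k) k e)) ⟩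
          (k + e) * fall r k        ≡⟨ cong (_* fall r k) r≡ ⟩
          r * fall r k              ≡⟨ cong (r *_) (fall-suc r′ κ) ⟩
          r * (fall r′ k + k * fall r′ κ) ≡⟨ a1 r (fall r′ k) k (fall r′ κ) ⟩
          r * fall r′ k + k * fall r k ∎)
          where
          open ≡-Reasoning
          a1 : ∀ r p k o → r * (p + k * o) ≡ r * p + k * (r * o)
          a1 = solve-∀
        inv′ : Φ (c ∷ T) * fall r₀ k ≤ C * fall r′ k
        inv′ = *-cancelˡ-≤ r (begin
          r * (Φ (c ∷ T) * fall r₀ k)  ≡⟨ *-assoc r (Φ (c ∷ T)) _ ⟨
          r * Φ (c ∷ T) * fall r₀ k    ≤⟨ *-monoˡ-≤ (fall r₀ k) decrease ⟩
          e * Φ T * fall r₀ k          ≡⟨ *-assoc e (Φ T) _ ⟩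
          e * (Φ T * fall r₀ k)        ≤⟨ *-monoʳ-≤ e inv ⟩
          e * (C * fall r k)           ≡⟨ rot e C (fall r k) ⟩
          C * (e * fall r k)           ≡⟨ cong (C *_) fall-decrease ⟩
          C * (r * fall r′ k)          ≡⟨ rot C r (fall r′ k) ⟩
          r * (C * fall r′ k)          ∎)
          where
          open ≤-Reasoning
          rot : ∀ a b c → a * (b * c) ≡ b * (a * c)
          rot = solve-∀

-- If q v > r then v - k ≥ 16 r / E, while d ≤ 8 r₀ / (8q + 1); so (v - k) / r exceeds d / r₀ by the
-- factor (E + 1) / E, whose k-th power is at least 2 ^ t.
moment-bound⇒sparse : ∀ {q t d r₀ K v r} .{{_ : NonZero q}} (let E = suc (16 * q)) (let k = E * t) →
  K < 2 ^ t → 0 < d → d ≤ r₀ → k ≤ r₀ → suc (8 * q) * d ≤ 8 * r₀ → 0 < r → q * E * k ≤ r →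
  fall v k * fall r₀ k ≤ K * fall d k * fall r k → q * v ≤ r
moment-bound⇒sparse {q} {t} {d} {r₀} {K} {v} {r} K<2^t 0<d d≤r₀ k≤r₀ d-small 0<r qEk≤r moments = ≮⇒≥ impossible
  where
  open ≤-Reasoning
  E = suc (16 * q)
  k = E * t
  impossible : ¬ (r < q * v)
  -- As k = E * t, Bernoulli puts (E + 1)^k above 2^t E^k, while the moment bound puts it below K
  -- E^k.
  impossible r<qv = <⇒≱ K<2^t (*-cancelʳ-≤ (2 ^ t) K (E ^ k) {{m^n≢0 E k}} (begin
    2 ^ t * E ^ k ≤⟨ 2^t*a^[a*t]≤[1+a]^[a*t] E t ⟩
    suc E ^ k     ≤⟨ powers ⟩
    K * E ^ k     ∎))
    where
    k≤v : k ≤ v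
    k≤v = *-cancelˡ-≤ q (begin
      q * k       ≤⟨ *-monoˡ-≤ k (m≤m*n q E) ⟩
      q * E * k   ≤⟨ qEk≤r ⟩
      r           ≤⟨ <⇒≤ r<qv ⟩
      q * v       ∎)
    s = v ∸ k
    v≡ : s + k ≡ v
    v≡ = m∸n+n≡m k≤v
    -- Of the E = 16 q + 1 multiples of r, passing from v to s = v - k uses up at most one, by q * E
    -- * k ≤ r.
    16r≤Es : 16 * r ≤ E * s
    16r≤Es = *-cancelˡ-≤ q (+-cancelʳ-≤ r _ _ (begin
      q * (16 * r) + r       ≡⟨ a1 q r ⟩
      E * r                  ≤⟨ *-monoʳ-≤ E (<⇒≤ r<qv) ⟩
      E * (q * v)            ≡⟨ cong (λ z → E * (q * z)) v≡ ⟨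
      E * (q * (s + k))      ≡⟨ a2 E q s k ⟩
      q * (E * s) + q * E * k ≤⟨ +-monoʳ-≤ (q * (E * s)) qEk≤r ⟩
      q * (E * s) + r        ∎))
      where
      a1 : ∀ q r → q * (16 * r) + r ≡ suc (16 * q) * r
      a1 = solve-∀
      a2 : ∀ E q s k → E * (q * (s + k)) ≡ q * (E * s) + q * E * k
      a2 = solve-∀
    -- `suc E` is twice `suc (8 * q)`, which lets `d-small` apply.
    ratio≤ : suc E * (d * r) ≤ E * (s * r₀)
    ratio≤ = begin
      suc (suc (16 * q)) * (d * r)  ≡⟨ a1 q d r ⟩
      2 * r * (suc (8 * q) * d)     ≤⟨ *-monoʳ-≤ (2 * r) d-small ⟩
      2 * r * (8 * r₀)              ≡⟨ a2 r r₀ ⟩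
      16 * r * r₀                   ≤⟨ *-monoˡ-≤ r₀ 16r≤Es ⟩
      E * s * r₀                    ≡⟨ *-assoc E s r₀ ⟩
      E * (s * r₀)                  ∎
      where
      a1 : ∀ q d r → suc (suc (16 * q)) * (d * r) ≡ 2 * r * (suc (8 * q) * d)
      a1 = solve-∀
      a2 : ∀ r r₀ → 2 * r * (8 * r₀) ≡ 16 * r * r₀
      a2 = solve-∀
    -- Falling factorials become powers: `fall v k` is at least s^k, `fall r k` at most r^k, and
    -- `fall-ratio` compares d with r₀.
    moments′ : (s * r₀) ^ k ≤ K * (d * r) ^ k
    moments′ = *-cancelʳ-≤ _ _ (fall r₀ k) {{>-nonZero (fall-pos k k≤r₀)}} (begin
      (s * r₀) ^ k * fall r₀ k               ≡⟨ cong (_* fall r₀ k) (^-distribʳ-* s r₀ k) ⟩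
      s ^ k * r₀ ^ k * fall r₀ k             ≤⟨ *-monoˡ-≤ (fall r₀ k) (*-monoˡ-≤ (r₀ ^ k) (≤-trans (^≤fall s k) (≤-reflexive (cong (λ z → fall z k) v≡)))) ⟩
      fall v k * r₀ ^ k * fall r₀ k            ≡⟨ a1 (fall v k) (r₀ ^ k) (fall r₀ k) ⟩
      fall v k * fall r₀ k * r₀ ^ k            ≤⟨ *-monoˡ-≤ (r₀ ^ k) moments ⟩
      K * fall d k * fall r k * r₀ ^ k         ≡⟨ a2 K (fall d k) (fall r k) (r₀ ^ k) ⟩
      K * fall r k * (fall d k * r₀ ^ k)       ≤⟨ *-mono-≤ (*-monoʳ-≤ K (fall≤^ r k)) (fall-ratio k d≤r₀) ⟩
      K * r ^ k * (d ^ k * fall r₀ k)        ≡⟨ a3 K (r ^ k) (d ^ k) (fall r₀ k) ⟩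
      K * (d ^ k * r ^ k) * fall r₀ k        ≡⟨ cong (λ z → K * z * fall r₀ k) (^-distribʳ-* d r k) ⟨
      K * (d * r) ^ k * fall r₀ k            ∎)
      where
      a1 : ∀ a b c → a * b * c ≡ a * c * b
      a1 = solve-∀
      a2 : ∀ a b c e → a * b * c * e ≡ a * c * (b * e)
      a2 = solve-∀
      a3 : ∀ a b c e → a * b * (c * e) ≡ a * (c * b) * e
      a3 = solve-∀
    powers : suc E ^ k ≤ K * E ^ k
    powers = *-cancelʳ-≤ _ _ ((d * r) ^ k) {{m^n≢0 (d * r) k {{m*n≢0 d r {{>-nonZero 0<d}} {{>-nonZero 0<r}}}}}} (begin
      suc E ^ k * (d * r) ^ k      ≡⟨ ^-distribʳ-* (suc E) (d * r) k ⟨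
      (suc E * (d * r)) ^ k        ≤⟨ ^-monoˡ-≤ k ratio≤ ⟩
      (E * (s * r₀)) ^ k           ≡⟨ ^-distribʳ-* E (s * r₀) k ⟩
      E ^ k * (s * r₀) ^ k         ≤⟨ *-monoʳ-≤ (E ^ k) moments′ ⟩
      E ^ k * (K * (d * r) ^ k)    ≡⟨ a1 (E ^ k) K ((d * r) ^ k) ⟩
      K * E ^ k * (d * r) ^ k      ∎)
      where
      a1 : ∀ a b c → a * (b * c) ≡ b * a * c
      a1 = solve-∀

-- Absorbers

does-true : (A? : Dec A) → does A? ≡ true → A
does-true (yes a) _ = a

∑-filter-≤ : ∀ {P : A → Set} (P? : ∀ x → Dec (P x)) xs f → ∑ (filter P? xs) f ≤ ∑ xs f
∑-filter-≤ P? []       f = z≤n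
∑-filter-≤ P? (x ∷ xs) f with does (P? x)
... | true  = +-monoʳ-≤ (f x) (∑-filter-≤ P? xs f)
... | false = m≤n⇒m≤o+n (f x) (∑-filter-≤ P? xs f)

-- Greedy covering of tests

module Covering {A Test : Set} (good : A → Test → Bool) (tests : List Test) where

  hitCount : List A → Test → ℕ
  hitCount F τ = ∑ F (λ c → ⟦ good c τ ⟧)

  penalty : Bool → ℕ
  penalty true  = 1
  penalty false = 2

  -- This is 2 to the power `length F` minus the number of hits: doubling on every miss avoids
  -- fractions.
  weight : List A → Test → ℕ
  weight []      τ = 1
  weight (c ∷ F) τ = penalty (good c τ) * weight F τ

  weight-hitCount : ∀ F τ → weight F τ * 2 ^ hitCount F τ ≡ 2 ^ length F
  weight-hitCount []      τ = refl
  weight-hitCount (c ∷ F) τ with good c τ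
  ... | true  = trans (rot (weight F τ) (2 ^ hitCount F τ)) (cong (2 *_) (weight-hitCount F τ))
    where
    rot : ∀ a b → (a + 0) * (b + (b + 0)) ≡ 2 * (a * b)
    rot = solve-∀
  ... | false = trans (*-assoc 2 (weight F τ) _) (cong (2 *_) (weight-hitCount F τ))

  Φ : List A → ℕ
  Φ F = ∑ tests (weight F)

  Φ-step : ∀ c F → Φ (c ∷ F) + ∑ tests (λ τ → ⟦ good c τ ⟧ * weight F τ) ≡ 2 * Φ F
  Φ-step c F = trans (sym (∑-distrib-+ tests _ _))
    (trans (∑-cong tests (λ τ → split (good c τ) (weight F τ))) (∑-distribˡ-* tests 2 _))
    where
    split : ∀ b w → penalty b * w + ⟦ b ⟧ * w ≡ 2 * w
    split true  w = cong (_+ (w + 0)) (+-identityʳ w)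
    split false w = +-identityʳ _

  -- Each test is hit by a proportion 1/N of the candidates, so an average candidate hits a
  -- proportion 1/N of the total weight.
  heavyCandidate : ∀ N cands (w : Test → ℕ) → 0 < length cands →
    (∀ τ → length cands ≤ N * hitCount cands τ) →
    ∃[ c ] c ∈ cands × ∑ tests w ≤ N * ∑ tests (λ τ → ⟦ good c τ ⟧ * w τ)
  heavyCandidate N cands w nonempty dense = averaging _ _ nonempty (begin
    ∑ cands (λ _ → ∑ tests w)                                ≡⟨ ∑-const cands _ ⟩
    length cands * ∑ tests w                                 ≡⟨ ∑-distribˡ-* tests (length cands) w ⟨
    ∑ tests (λ τ → length cands * w τ)                       ≤⟨ ∑-mono tests (λ τ → *-monoˡ-≤ (w τ) (dense τ)) ⟩
    ∑ tests (λ τ → N * hitCount cands τ * w τ)               ≡⟨ ∑-cong tests (λ τ → trans (*-assoc N _ (w τ))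
                                                                  (cong (N *_) (sym (∑-distribʳ-* cands _ (w τ))))) ⟩
    ∑ tests (λ τ → N * ∑ cands (λ c → ⟦ good c τ ⟧ * w τ))   ≡⟨ ∑-distribˡ-* tests N _ ⟩
    N * ∑ tests (λ τ → ∑ cands (λ c → ⟦ good c τ ⟧ * w τ))   ≡⟨ cong (N *_) (∑-swap tests cands _) ⟩
    N * ∑ cands (λ c → ∑ tests (λ τ → ⟦ good c τ ⟧ * w τ))   ≡⟨ ∑-distribˡ-* cands N _ ⟨
    ∑ cands (λ c → N * ∑ tests (λ τ → ⟦ good c τ ⟧ * w τ))   ∎)
    where open ≤-Reasoning

  -- The new potential is 2 Φ minus the weight hit, which is at least Φ / N; hence the factor (2N -
  -- 1) / N = a / N.
  Φ-decrease : ∀ {N a} c F → suc a ≡ 2 * N →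
    Φ F ≤ N * ∑ tests (λ τ → ⟦ good c τ ⟧ * weight F τ) → N * Φ (c ∷ F) ≤ a * Φ F
  Φ-decrease {N} {a} c F 1+a≡2N heavy = +-cancelʳ-≤ (Φ F) _ _ (begin
    N * Φ (c ∷ F) + Φ F         ≤⟨ +-monoʳ-≤ (N * Φ (c ∷ F)) heavy ⟩
    N * Φ (c ∷ F) + N * S       ≡⟨ *-distribˡ-+ N (Φ (c ∷ F)) S ⟨
    N * (Φ (c ∷ F) + S)         ≡⟨ cong (N *_) (Φ-step c F) ⟩
    N * (2 * Φ F)               ≡⟨ rot N (Φ F) ⟩
    2 * N * Φ F                 ≡⟨ cong (_* Φ F) 1+a≡2N ⟨
    suc a * Φ F                 ≡⟨ +-comm (Φ F) (a * Φ F) ⟩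
    a * Φ F + Φ F               ∎)
    where
    open ≤-Reasoning
    S = ∑ tests (λ τ → ⟦ good c τ ⟧ * weight F τ)
    rot : ∀ N x → N * (2 * x) ≡ 2 * N * x
    rot = solve-∀

  -- With m = `length F`, a test hit fewer than s times has weight at least 2^(m - s). But `Φ` is at
  -- most (a/N)^m times the number of tests, and (2N/a)^m ≥ 2^(2s) because m = 2as; so there would
  -- be at least 2^s tests.
  Φ-small⇒covering : ∀ {N a s} F .{{_ : NonZero a}} → suc a ≡ 2 * N → length F ≡ a * (2 * s) →
    length tests < 2 ^ s → N ^ length F * Φ F ≤ a ^ length F * length tests →
    ∀ {τ} → τ ∈ tests → s ≤ hitCount F τ
  Φ-small⇒covering {N} {a} {s} F 1+a≡2N len few small {τ} τ∈ = ≮⇒≥ impossible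
    where
    open ≤-Reasoning
    m = length F
    impossible : ¬ (hitCount F τ < s)
    impossible hits<s = <⇒≱ few (*-cancelˡ-≤ (2 ^ s) {{m^n≢0 2 s}}
      (*-cancelʳ-≤ _ _ (a ^ m) {{m^n≢0 a m}} (begin
      2 ^ s * 2 ^ s * a ^ m               ≡⟨ cong (_* a ^ m) (^-distribˡ-+-* 2 s s) ⟨
      2 ^ (s + s) * a ^ m                 ≡⟨ cong₂ (λ x y → 2 ^ x * a ^ y) (cong (s +_) (sym (+-identityʳ s))) len ⟩
      2 ^ (2 * s) * a ^ (a * (2 * s))     ≤⟨ 2^t*a^[a*t]≤[1+a]^[a*t] a (2 * s) ⟩
      suc a ^ (a * (2 * s))               ≡⟨ cong₂ _^_ 1+a≡2N (sym len) ⟩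
      (2 * N) ^ m                         ≡⟨ ^-distribʳ-* 2 N m ⟩
      2 ^ m * N ^ m                       ≡⟨ cong (_* N ^ m) (weight-hitCount F τ) ⟨
      weight F τ * 2 ^ hitCount F τ * N ^ m
        ≤⟨ *-monoˡ-≤ (N ^ m) (*-mono-≤ (∈⇒≤∑ (weight F) τ∈) (^-monoʳ-≤ 2 (<⇒≤ hits<s))) ⟩
      Φ F * 2 ^ s * N ^ m                 ≡⟨ e1 (Φ F) (2 ^ s) (N ^ m) ⟩
      2 ^ s * (N ^ m * Φ F)               ≤⟨ *-monoʳ-≤ (2 ^ s) small ⟩
      2 ^ s * (a ^ m * length tests)      ≡⟨ e2 (2 ^ s) (a ^ m) (length tests) ⟩
      2 ^ s * length tests * a ^ m        ∎)))
      where
      e1 : ∀ x y z → x * y * z ≡ y * (z * x)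
      e1 = solve-∀
      e2 : ∀ x y z → x * (y * z) ≡ x * z * y
      e2 = solve-∀

prod : ∀ {p} → (Fin p → List A) → List (Vec A p)
prod {p = zero}  R = [] ∷ []
prod {p = suc p} R = concatMap (λ a → map (a ∷_) (prod (R ∘ suc))) (R zero)

∑-prod : ∀ {p} (R : Fin (suc p) → List A) f → ∑ (prod R) f ≡ ∑ (R zero) (λ a → ∑ (prod (R ∘ suc)) (λ v → f (a ∷ v)))
∑-prod R f = trans (∑-concatMap (λ a → map (a ∷_) (prod (R ∘ suc))) (R zero) f)
  (∑-cong (R zero) (λ a → ∑-map (a ∷_) (prod (R ∘ suc)) f))

length-prod : ∀ {p m} (R : Fin p → List A) → (∀ j → length (R j) ≤ m) → length (prod R) ≤ m ^ p
length-prod {p = zero}  R le = ≤-refl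
length-prod {p = suc p} {m} R le = begin
  length (prod R)                                            ≡⟨ length≡∑1 (prod R) ⟩
  ∑ (prod R) (λ _ → 1)                                       ≡⟨ ∑-prod R (λ _ → 1) ⟩
  ∑ (R zero) (λ _ → ∑ (prod (R ∘ suc)) (λ _ → 1))            ≡⟨ ∑-const (R zero) _ ⟩
  length (R zero) * ∑ (prod (R ∘ suc)) (λ _ → 1)             ≡⟨ cong (length (R zero) *_) (length≡∑1 (prod (R ∘ suc))) ⟨
  length (R zero) * length (prod (R ∘ suc))                  ≤⟨ *-mono-≤ (le zero) (length-prod (R ∘ suc) (le ∘ suc)) ⟩
  m * m ^ p                                                  ∎
  where open ≤-Reasoning

∈-prod⁺ : ∀ {p} {R : Fin p → List A} v → (∀ j → lookup v j ∈ R j) → v ∈ prod R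
∈-prod⁺ []      _  = here refl
∈-prod⁺ {R = R} (a ∷ v) v∈ = ∈-concatMap⁺ (λ a → map (a ∷_) (prod (R ∘ suc)))
  (Any.map (λ { refl → ∈-map⁺ (a ∷_) (∈-prod⁺ v (v∈ ∘ suc)) }) (v∈ zero))

∈-prod⁻ : ∀ {p} {R : Fin p → List A} {v} → v ∈ prod R → ∀ j → lookup v j ∈ R j
∈-prod⁻ {p = suc p} {R = R} v∈ j with find (∈-concatMap⁻ (λ a → map (a ∷_) (prod (R ∘ suc))) {xs = R zero} v∈)
... | a , a∈ , v∈′ with ∈-map⁻ (a ∷_) v∈′
∈-prod⁻ v∈ zero    | a , a∈ , v∈′ | u , u∈ , refl = a∈
∈-prod⁻ v∈ (suc j) | a , a∈ , v∈′ | u , u∈ , refl = ∈-prod⁻ u∈ j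

later : ∀ {p} → Fin p → List (Fin p)
later {suc p} zero    = map suc (allFin p)
later {suc p} (suc i) = map suc (later i)

length-later : ∀ {p} (i : Fin p) → length (later i) + toℕ i ≤ p
length-later {suc p} zero = ≤-trans
  (≤-reflexive (trans (+-identityʳ _) (trans (length-map Fin.suc (allFin p)) (length-allFin p)))) (n≤1+n p)
length-later {suc p} (suc i) rewrite length-map Fin.suc (later i) | +-suc (length (later i)) (toℕ i) = s≤s (length-later i)

∈-later⁺ : ∀ {p} {i k : Fin p} → i Fin.< k → k ∈ later i
∈-later⁺ {i = zero}  {suc k} _         = ∈-map⁺ suc (∈-allFin k)
∈-later⁺ {i = suc i} {suc k} (s≤s i<k) = ∈-map⁺ suc (∈-later⁺ i<k)

∈-later⁻ : ∀ {p} {i k : Fin p} → k ∈ later i → i Fin.< k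
∈-later⁻ {i = zero} k∈ with ∈-map⁻ suc k∈
... | _ , _ , refl = s≤s z≤n
∈-later⁻ {i = suc i} k∈ with ∈-map⁻ suc k∈
... | _ , k∈′ , refl = s≤s (∈-later⁻ k∈′)

module Absorbers {q n : ℕ} (G : BalancedPartiteGraph q n) where

  open Tiling G public

  Clique? : ∀ c → Dec (Clique c)
  Clique? c = Fin.all? λ i → Fin.all? λ j → ¬? (i Fin.≟ j) →-dec (adj G (i , lookup c i) (j , lookup c j) Bool.≟ true)

  -- Each chosen vertex joins the constraint lists of all classes still to be served.
  extends : ∀ {p} → (Fin p → Fin q) → (Fin p → List (Vertex q n)) → Vec (Fin n) p → Bool
  extends cls L []      = true
  extends cls L (a ∷ v) = adjAll (L zero) (cls zero , a) ∧ extends (cls ∘ suc) (λ j → (cls zero , a) ∷ L (suc j)) v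

  -- A chosen vertex is put on the constraint lists of all later classes, so meeting the constraints
  -- includes pairwise adjacency.
  extends-sound : ∀ {p} (cls : Fin p → Fin q) L v → extends cls L v ≡ true →
    (∀ j → adjAll (L j) (cls j , lookup v j) ≡ true) ×
    (∀ i j → i ≢ j → adj G (cls i , lookup v i) (cls j , lookup v j) ≡ true)
  extends-sound cls L []      eq = (λ ()) , (λ ())
  extends-sound cls L (a ∷ v) eq = constraints , pairs
    where
    IH = extends-sound (cls ∘ suc) _ v (∧-trueʳ {adjAll (L zero) (cls zero , a)} eq)
    constraints : ∀ j → adjAll (L j) (cls j , lookup (a ∷ v) j) ≡ true
    constraints zero    = ∧-trueˡ eq
    constraints (suc j) = ∧-trueʳ {adj G (cls zero , a) (cls (suc j) , lookup v j)} (proj₁ IH j)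
    pairs : ∀ i j → i ≢ j → adj G (cls i , lookup (a ∷ v) i) (cls j , lookup (a ∷ v) j) ≡ true
    pairs zero    zero    i≢j = ⊥-elim (i≢j refl)
    pairs zero    (suc j) _   = ∧-trueˡ (proj₁ IH j)
    pairs (suc i) zero    _   = trans (symmetric G _ _) (∧-trueˡ (proj₁ IH i))
    pairs (suc i) (suc j) i≢j = proj₂ IH i j (i≢j ∘ cong suc)

  -- Every class offers at least B choices. Each choice lengthens the remaining lists by one while
  -- their indices drop by one, so the bound q on length plus index persists.
  extends-count : ∀ {p B} (cls : Fin p → Fin q) L (R : Fin p → List (Fin n)) →
    (∀ {i j} → cls i ≡ cls j → i ≡ j) →
    (∀ j {x} → x ∈ L j → cls j ≢ proj₁ x) →
    (∀ j → length (L j) + toℕ j ≤ q) →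
    (∀ j xs → length xs ≤ q → (∀ {x} → x ∈ xs → cls j ≢ proj₁ x) →
      B ≤ ∑ (R j) (λ a → ⟦ adjAll xs (cls j , a) ⟧)) →
    B ^ p ≤ ∑ (prod R) (λ v → ⟦ extends cls L v ⟧)
  extends-count {zero}      cls L R inj diff short many = ≤-refl
  extends-count {suc p} {B} cls L R inj diff short many = begin
    B * B ^ p
      ≤⟨ *-monoˡ-≤ (B ^ p) (many zero (L zero) (≤-trans (m≤m+n _ 0) (short zero)) (diff zero)) ⟩
    ∑ (R zero) (λ a → ⟦ adjAll (L zero) (cls zero , a) ⟧) * B ^ p
      ≡⟨ ∑-distribʳ-* (R zero) _ (B ^ p) ⟨
    ∑ (R zero) (λ a → ⟦ adjAll (L zero) (cls zero , a) ⟧ * B ^ p)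
      ≤⟨ ∑-mono (R zero) (λ a → branch a (adjAll (L zero) (cls zero , a))) ⟩
    ∑ (R zero) (λ a → ∑ (prod (R ∘ suc)) (λ v → ⟦ extends cls L (a ∷ v) ⟧))
      ≡⟨ ∑-prod R _ ⟨
    ∑ (prod R) (λ v → ⟦ extends cls L v ⟧) ∎
    where
    open ≤-Reasoning
    L′ : Fin n → Fin p → List (Vertex q n)
    L′ a j = (cls zero , a) ∷ L (suc j)
    diff′ : ∀ a j {x} → x ∈ L′ a j → cls (suc j) ≢ proj₁ x
    diff′ a j (here refl) eq with inj eq
    ... | ()
    diff′ a j (there x∈)  eq = diff (suc j) x∈ eq
    branch : ∀ a b → ⟦ b ⟧ * B ^ p ≤ ∑ (prod (R ∘ suc)) (λ v → ⟦ b ∧ extends (cls ∘ suc) (L′ a) v ⟧)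
    branch a false = z≤n
    branch a true  = ≤-trans (≤-reflexive (+-identityʳ _))
      (extends-count (cls ∘ suc) (L′ a) (R ∘ suc) (Fin.suc-injective ∘ inj) (diff′ a)
        (λ j → subst (_≤ q) (+-suc (length (L (suc j))) (toℕ j)) (short (suc j))) (many ∘ suc))

  Test : Set
  Test = Fin q × Fin n × Transversal

  -- Reading classes in increasing order, class j faces at most q constraints in total: class i has
  -- its i predecessors and the q - 1 - i vertices y_k with k > i, any other class its predecessors and x.
  constraints : Test → Fin q → List (Vertex q n)
  constraints (i , x , y) j with j Fin.≟ i
  ... | yes _ = map (λ k → k , lookup y k) (later i)
  ... | no  _ = (i , x) ∷ []

  constraints-outside : ∀ τ j {x} → x ∈ constraints τ j → j ≢ proj₁ x
  constraints-outside (i , x , y) j z∈ with j Fin.≟ i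
  constraints-outside (i , x , y) j z∈          | yes refl with ∈-map⁻ _ z∈
  ... | k , k∈ , refl = Fin.<⇒≢ (∈-later⁻ k∈)
  constraints-outside (i , x , y) j (here refl) | no j≢i = j≢i

  constraints-short : ∀ τ j → length (constraints τ j) + toℕ j ≤ q
  constraints-short (i , x , y) j with j Fin.≟ i
  ... | yes refl rewrite length-map (λ k → k , lookup y k) (later i) = length-later i
  ... | no _     = Fin.toℕ<n j

  Good : Transversal → Test → Set
  Good c τ = ∀ j → adjAll (constraints τ j) (j , lookup c j) ≡ true

  Good? : ∀ c τ → Dec (Good c τ)
  Good? c τ = Fin.all? λ j → adjAll (constraints τ j) (j , lookup c j) Bool.≟ true

  good : Transversal → Test → Bool
  good c τ = does (Good? c τ)

  tests : List Test
  tests = cartesianProduct (allFin q) (cartesianProduct (allFin n) (prod (λ _ → allFin n)))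

  ∈-tests : ∀ τ → τ ∈ tests
  ∈-tests (i , x , y) = ∈-cartesianProduct⁺ (∈-allFin i)
    (∈-cartesianProduct⁺ (∈-allFin x) (∈-prod⁺ y (λ j → ∈-allFin (lookup y j))))

  length-tests : length tests ≤ q * (n * n ^ q)
  length-tests
    rewrite length-× (allFin q) (cartesianProduct (allFin n) (prod {p = q} (λ _ → allFin n)))
          | length-× (allFin n) (prod {p = q} (λ _ → allFin n)) | length-allFin q | length-allFin n =
    *-monoʳ-≤ q (*-monoʳ-≤ n (length-prod {p = q} (λ _ → allFin n) (λ _ → ≤-reflexive (length-allFin n))))

  open Covering good tests public

  nonNeighbours-free : ∀ T x j → nonNeighbours x j (free T j) ≤ nonNeighbours x j (allFin n)
  nonNeighbours-free []      x j = ≤-refl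
  nonNeighbours-free (c ∷ T) x j = ≤-trans (∑-filter-≤ _ (free T j) _) (nonNeighbours-free T x j)

  length-free-≤ : ∀ T j → length (free T j) ≤ n
  length-free-≤ []      j = ≤-reflexive (length-allFin n)
  length-free-≤ (c ∷ T) j = ≤-trans (length-filter _ (free T j)) (length-free-≤ T j)

  module Selection {d m β B : ℕ} (few : ∀ x j → j ≢ proj₁ x → nonNeighbours x j (allFin n) ≤ d)
    (0<B : 0 < B) (B-small : B + q * d + m ≤ n) (B-large : n ≤ β * B) where

    N = β ^ q

    candidates : List Transversal → List Transversal
    candidates T = filter Clique? (prod (free T))

    -- At least n - m vertices of the class are uncovered, and at most q constraints exclude d of
    -- them each.
    many-neighbours : ∀ T → AllPairs Disjoint T → length T ≤ m → ∀ j xs → length xs ≤ q →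
      (∀ {x} → x ∈ xs → j ≢ proj₁ x) → B ≤ ∑ (free T j) (λ a → ⟦ adjAll xs (j , a) ⟧)
    many-neighbours T ap len j xs short diff = +-cancelʳ-≤ (q * d) _ _ (+-cancelʳ-≤ m _ _ (begin
      B + q * d + m              ≤⟨ B-small ⟩
      n                          ≡⟨ length-free T j ap ⟨
      length T + length (free T j) ≤⟨ +-monoˡ-≤ _ len ⟩
      m + length (free T j)      ≡⟨ +-comm m _ ⟩
      length (free T j) + m      ≡⟨ cong (_+ m) (length≡∑1 (free T j)) ⟩
      ∑ (free T j) (λ _ → 1) + m ≤⟨ +-monoˡ-≤ m (common-neighbours (free T j) (λ _ → true) xs
                                     (λ x j≢ → ≤-trans (nonNeighbours-free T x j) (few x j j≢)) diff) ⟩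
      ∑ (free T j) (λ a → ⟦ adjAll xs (j , a) ∧ true ⟧) + length xs * d + m
        ≤⟨ +-monoˡ-≤ m (+-mono-≤ (≤-reflexive (∑-cong (free T j) (λ a → cong ⟦_⟧ (∧-identityʳ _)))) (*-monoˡ-≤ d short)) ⟩
      ∑ (free T j) (λ a → ⟦ adjAll xs (j , a) ⟧) + q * d + m ∎))
      where open ≤-Reasoning

    good-candidates : ∀ T → AllPairs Disjoint T → length T ≤ m → ∀ τ → B ^ q ≤ hitCount (candidates T) τ
    good-candidates T ap len τ = begin
      B ^ q
        ≤⟨ extends-count id (constraints τ) (free T) id (constraints-outside τ) (constraints-short τ)
             (many-neighbours T ap len) ⟩
      ∑ (prod (free T)) (λ v → ⟦ extends id (constraints τ) v ⟧)
        ≤⟨ ∑-mono (prod (free T)) sound ⟩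
      ∑ (prod (free T)) (λ v → ⟦ does (Clique? v) ⟧ * ⟦ good v τ ⟧)
        ≡⟨ ∑-filter Clique? (prod (free T)) _ ⟨
      hitCount (candidates T) τ ∎
      where
      open ≤-Reasoning
      sound : ∀ v → ⟦ extends id (constraints τ) v ⟧ ≤ ⟦ does (Clique? v) ⟧ * ⟦ good v τ ⟧
      sound v with extends id (constraints τ) v in eq
      ... | false = z≤n
      ... | true  = ≤-reflexive (sym (cong₂ (λ x y → ⟦ x ⟧ * ⟦ y ⟧)
              (dec-true (Clique? v) (proj₂ (extends-sound id _ v eq)))
              (dec-true (Good? v τ) (proj₁ (extends-sound id _ v eq)))))

    -- There are at most n^q candidates, at least B^q of them are good for τ, and n ≤ β * B.
    candidates-dense : ∀ T → AllPairs Disjoint T → length T ≤ m → ∀ τ →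
      length (candidates T) ≤ N * hitCount (candidates T) τ
    candidates-dense T ap len τ = begin
      length (candidates T)        ≤⟨ length-filter Clique? (prod (free T)) ⟩
      length (prod (free T))       ≤⟨ length-prod (free T) (length-free-≤ T) ⟩
      n ^ q                        ≤⟨ ^-monoˡ-≤ q B-large ⟩
      (β * B) ^ q                  ≡⟨ ^-distribʳ-* β B q ⟩
      N * B ^ q                    ≤⟨ *-monoʳ-≤ N (good-candidates T ap len τ) ⟩
      N * hitCount (candidates T) τ ∎
      where open ≤-Reasoning

    candidates-nonempty : ∀ T → AllPairs Disjoint T → length T ≤ m → Test → 0 < length (candidates T)
    candidates-nonempty T ap len τ = begin
      1                         ≤⟨ m^n>0 B {{>-nonZero 0<B}} q ⟩
      B ^ q                     ≤⟨ good-candidates T ap len τ ⟩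
      hitCount (candidates T) τ ≤⟨ count≤length (candidates T) _ ⟩
      length (candidates T)     ∎
      where open ≤-Reasoning

    -- Iterates `Φ-decrease`; g ≤ m keeps enough vertices uncovered for the density bound. The given
    -- test witnesses that candidates exist.
    select : Test → ∀ {a} → suc a ≡ 2 * N → ∀ g → g ≤ m →
      ∃[ F ] AllPairs Disjoint F × All Clique F × length F ≡ g × N ^ g * Φ F ≤ a ^ g * length tests
    select τ 1+a≡2N zero    g≤m = [] , [] , [] , refl ,
      ≤-reflexive (cong (_+ 0) (sym (length≡∑1 tests)))
    select τ {a} 1+a≡2N (suc g) g≤m with select τ 1+a≡2N g (<⇒≤ g≤m)
    ... | F , ap , cl , refl , small = extended
      where
      open ≤-Reasoning
      len = <⇒≤ g≤m
      extended : ∃[ F′ ] AllPairs Disjoint F′ × All Clique F′ × length F′ ≡ suc (length F)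
        × N ^ suc (length F) * Φ F′ ≤ a ^ suc (length F) * length tests
      extended with heavyCandidate N (candidates F) (weight F) (candidates-nonempty F ap len τ) (candidates-dense F ap len)
      ... | c , c∈ , heavy with ∈-filter⁻ Clique? {xs = prod (free F)} c∈
      ... | c∈′ , clique = c ∷ F , free⇒fresh {c} (∈-prod⁻ c∈′) ∷ ap , clique ∷ cl , refl , (begin
        N * N ^ length F * Φ (c ∷ F)      ≡⟨ e1 N (N ^ length F) (Φ (c ∷ F)) ⟩
        N ^ length F * (N * Φ (c ∷ F))    ≤⟨ *-monoʳ-≤ (N ^ length F) (Φ-decrease {N} c F 1+a≡2N heavy) ⟩
        N ^ length F * (a * Φ F)          ≡⟨ e2 (N ^ length F) a (Φ F) ⟩
        a * (N ^ length F * Φ F)          ≤⟨ *-monoʳ-≤ a small ⟩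
        a * (a ^ length F * length tests) ≡⟨ *-assoc a _ _ ⟨
        a * a ^ length F * length tests   ∎)
        where
        e1 : ∀ x y z → x * y * z ≡ y * (x * z)
        e1 = solve-∀
        e2 : ∀ x y z → x * (y * z) ≡ y * (x * z)
        e2 = solve-∀

-- Absorption

lookup-update : ∀ {A : Set} {p} (P : Fin p → A → Set) (v : Vec A p) i a →
  P i a → (∀ j → j ≢ i → P j (lookup v j)) → ∀ j → P j (lookup (v [ i ]≔ a) j)
lookup-update P v i a new old j with j Fin.≟ i
... | yes refl = subst (P i) (sym (lookup∘update i v a)) new
... | no j≢i   = subst (P j) (sym (lookup∘update′ j≢i v a)) (old j j≢i)

module Absorption {q n : ℕ} (G : BalancedPartiteGraph q n) where

  open Absorbers G

  Disjoint-sym : ∀ {c d} → Disjoint c d → Disjoint d c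
  Disjoint-sym dis j eq = dis j (sym eq)

  AllPairs-↭ : ∀ {xs ys} → xs ↭ ys → AllPairs Disjoint xs → AllPairs Disjoint ys
  AllPairs-↭ p = Permutationₛ.AllPairs-resp-↭ (setoid Transversal) (λ {c} {d} → Disjoint-sym {c} {d})
    ((λ { refl dis → dis }) , (λ { refl dis → dis })) (↭⇒↭ₛ p)

  -- Swapping two entries within one class leaves the set of covered vertices unchanged.
  exchange-disjoint : ∀ i {z t T} → AllPairs Disjoint (z ∷ t ∷ T) →
    AllPairs Disjoint ((z [ i ]≔ lookup t i) ∷ (t [ i ]≔ lookup z i) ∷ T)
  exchange-disjoint i {z} {t} {T} ((zt ∷ zT) ∷ tT ∷ ap) = (zt′ ∷ zT′) ∷ tT′ ∷ ap
    where
    zt′ : Disjoint (z [ i ]≔ lookup t i) (t [ i ]≔ lookup z i)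
    zt′ = lookup-update (λ j a → a ≢ lookup (t [ i ]≔ lookup z i) j) z i (lookup t i)
      (λ eq → zt i (sym (trans eq (lookup∘update i t _))))
      (λ j j≢i eq → zt j (trans eq (lookup∘update′ j≢i t _)))
    zT′ : All (Disjoint (z [ i ]≔ lookup t i)) T
    zT′ = All.tabulate λ {d} d∈ → lookup-update (λ j a → a ≢ lookup d j) z i (lookup t i)
      (All.lookup tT d∈ i) (λ j _ → All.lookup zT d∈ j)
    tT′ : All (Disjoint (t [ i ]≔ lookup z i)) T
    tT′ = All.tabulate λ {d} d∈ → lookup-update (λ j a → a ≢ lookup d j) t i (lookup z i)
      (All.lookup zT d∈ i) (λ j _ → All.lookup tT d∈ j)

  -- Measures the progress of an absorption: vacuous at q, a full clique at 0.
  CliqueFrom : ℕ → Transversal → Set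
  CliqueFrom i z = ∀ j k → i ≤ toℕ j → i ≤ toℕ k → j ≢ k → adj G (j , lookup z j) (k , lookup z k) ≡ true

  good-later : ∀ t {i x y} → Good t (i , x , y) → ∀ {k} → i Fin.< k → adj G (k , lookup y k) (i , lookup t i) ≡ true
  good-later t {i} {x} {y} g {k} i<k with g i
  ... | gi with i Fin.≟ i
  ... | yes _  = adjAll⁻ gi (∈-map⁺ (λ k → k , lookup y k) (∈-later⁺ i<k))
  ... | no i≢i = ⊥-elim (i≢i refl)

  good-other : ∀ t {i x y} → Good t (i , x , y) → ∀ {j} → j ≢ i → adj G (i , x) (j , lookup t j) ≡ true
  good-other t {i} {x} {y} g {j} j≢i with g j
  ... | gj with j Fin.≟ i
  ... | yes j≡i = ⊥-elim (j≢i j≡i)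
  ... | no _    = adjAll⁻ {(i , x) ∷ []} gj (here refl)

  exchange-clique : ∀ t {i x y} → Good t (i , x , y) → Clique t → Clique (t [ i ]≔ x)
  exchange-clique t {i} {x} g cl j k = lookup-update (λ j a → j ≢ k → adj G (j , a) (k , lookup (t [ i ]≔ x) k) ≡ true) t i x
    (λ i≢k → lookup-update (λ k b → i ≢ k → adj G (i , x) (k , b) ≡ true) t i x
      (λ i≢i → ⊥-elim (i≢i refl)) (λ k k≢i _ → good-other t g k≢i) k i≢k)
    (λ j j≢i → lookup-update (λ k b → j ≢ k → adj G (j , lookup t j) (k , b) ≡ true) t i x
      (λ _ → trans (symmetric G _ _) (good-other t g j≢i)) (λ k _ → cl j k) k) j

  exchange-cliqueFrom : ∀ t {i x z} → Good t (i , x , z) → CliqueFrom (suc (toℕ i)) z →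
    CliqueFrom (toℕ i) (z [ i ]≔ lookup t i)
  exchange-cliqueFrom t {i} {x} {z} g cl j k =
    lookup-update (λ j a → toℕ i ≤ toℕ j → toℕ i ≤ toℕ k → j ≢ k → adj G (j , a) (k , lookup z′ k) ≡ true) z i (lookup t i)
      (λ _ → lookup-update (λ k b → toℕ i ≤ toℕ k → i ≢ k → adj G (i , lookup t i) (k , b) ≡ true) z i (lookup t i)
        (λ _ i≢i → ⊥-elim (i≢i refl)) (λ k k≢i i≤k _ → trans (symmetric G _ _) (good-later t g (strict i≤k k≢i))) k)
      (λ j j≢i i≤j → lookup-update (λ k b → toℕ i ≤ toℕ k → j ≢ k → adj G (j , lookup z j) (k , b) ≡ true) z i (lookup t i)
        (λ _ _ → good-later t g (strict i≤j j≢i)) (λ k k≢i i≤k → cl j k (strict i≤j j≢i) (strict i≤k k≢i)) k) j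
    where
    z′ = z [ i ]≔ lookup t i
    strict : ∀ {j} → toℕ i ≤ toℕ j → j ≢ i → toℕ i < toℕ j
    strict i≤j j≢i = ≤∧≢⇒< i≤j (λ eq → j≢i (sym (Fin.toℕ-injective eq)))

  -- Each exchange uses up one member t of `F`: its altered form may fail the tests that t passed,
  -- so it moves to `P`. Every test loses at most one hit, so after i exchanges e hits remain.
  absorb : ∀ i → i ≤ q → ∀ {e} F P z → (∀ τ → i + e ≤ hitCount F τ) →
    AllPairs Disjoint (z ∷ F ++ P) → All Clique (F ++ P) → CliqueFrom i z →
    ∃[ F′ ] ∃[ P′ ] (∀ τ → e ≤ hitCount F′ τ) × AllPairs Disjoint (F′ ++ P′) × All Clique (F′ ++ P′)
      × length (F′ ++ P′) ≡ suc (length (F ++ P))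
  absorb zero _ F P z hits ap cl clz = F , z ∷ P , hits , AllPairs-↭ perm ap ,
    All-resp-↭ perm ((λ j k → clz j k z≤n z≤n) ∷ cl) , sym (↭-length perm)
    where
    perm : z ∷ F ++ P ↭ F ++ z ∷ P
    perm = ↭-sym (shift z F P)
  absorb (suc i) i<q {e} F P z hits ap cl clz =
    F′ , P′ , hits′ , ap′ , cl′ , trans len′ (cong suc (trans (↭-length (shift t′ F₁ P)) (sym (↭-length F++P↭))))
    where
    j = fromℕ< i<q
    j≡i : toℕ j ≡ i
    j≡i = Fin.toℕ-fromℕ< i<q
    -- The test is built from the current z, already altered by earlier exchanges; this is why
    -- `hits` must cover all tests.
    τ : Test
    τ = j , lookup z j , z
    hit = positive-count F (λ c → good c τ) (≤-trans (s≤s z≤n) (hits τ))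
    t = proj₁ hit
    t-good : Good t τ
    t-good = does-true (Good? t τ) (proj₂ (proj₂ hit))
    F↭′ = ∈⇒↭ (proj₁ (proj₂ hit))
    F₁ = proj₁ F↭′
    F↭ = proj₂ F↭′
    F++P↭ : F ++ P ↭ t ∷ F₁ ++ P
    F++P↭ = ++⁺ʳ P F↭
    t′ = t [ j ]≔ lookup z j
    z′ = z [ j ]≔ lookup t j
    cl₁ : All Clique (t ∷ F₁ ++ P)
    cl₁ = All-resp-↭ F++P↭ cl
    hits₁ : ∀ τ → i + e ≤ hitCount F₁ τ
    hits₁ τ = ≤-pred (≤-trans (hits τ) (≤-trans (≤-reflexive (∑-↭ _ F↭)) (+-monoˡ-≤ _ (indicator≤1 (good t τ)))))
      where
      indicator≤1 : ∀ b → ⟦ b ⟧ ≤ 1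
      indicator≤1 true  = ≤-refl
      indicator≤1 false = z≤n
    rest = absorb i (<⇒≤ i<q) F₁ (t′ ∷ P) z′ hits₁
      (AllPairs-↭ (prep z′ (↭-sym (shift t′ F₁ P))) (exchange-disjoint j (AllPairs-↭ (prep z F++P↭) ap)))
      (All-resp-↭ (↭-sym (shift t′ F₁ P)) (exchange-clique t t-good (All.head cl₁) ∷ All.tail cl₁))
      (subst (λ i → CliqueFrom i z′) j≡i (exchange-cliqueFrom t t-good (subst (λ i → CliqueFrom (suc i) z) (sym j≡i) clz)))
    F′ = proj₁ rest
    P′ = proj₁ (proj₂ rest)
    hits′ = proj₁ (proj₂ (proj₂ rest))
    ap′ = proj₁ (proj₂ (proj₂ (proj₂ rest)))
    cl′ = proj₁ (proj₂ (proj₂ (proj₂ (proj₂ rest))))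
    len′ = proj₂ (proj₂ (proj₂ (proj₂ (proj₂ rest))))

  uncovered : ∀ T → AllPairs Disjoint T → length T < n → ∃[ z ] All (Disjoint z) T
  uncovered T ap len = z , free⇒fresh {z} (λ j → subst (_∈ free T j) (sym (lookup∘tabulate (proj₁ ∘ pick) j)) (proj₂ (pick j)))
    where
    first : ∀ (as : List (Fin n)) → 0 < length as → ∃[ a ] a ∈ as
    first (a ∷ _) _ = a , here refl
    pick : ∀ j → ∃[ a ] a ∈ free T j
    pick j = first (free T j) (+-cancelˡ-< (length T) _ _
      (subst₂ _<_ (sym (+-identityʳ _)) (sym (length-free T j ap)) len))
    z = Vec.tabulate (proj₁ ∘ pick)

  -- Each of the e missing cliques costs q hits per test.
  complete : ∀ e F P → (∀ τ → e * q ≤ hitCount F τ) → AllPairs Disjoint (F ++ P) → All Clique (F ++ P) →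
    length (F ++ P) + e ≡ n → ∃[ T ] AllPairs Disjoint T × All Clique T × length T ≡ n
  complete zero    F P hits ap cl len = F ++ P , ap , cl , trans (sym (+-identityʳ _)) len
  complete (suc e) F P hits ap cl len
    with uncovered (F ++ P) ap (≤-trans (s≤s (m≤m+n _ e)) (≤-reflexive (trans (sym (+-suc _ e)) len)))
  ... | z , dis
    with absorb q ≤-refl F P z hits (dis ∷ ap) cl (λ j _ q≤j → ⊥-elim (<⇒≱ (Fin.toℕ<n j) q≤j))
  ... | F′ , P′ , hits′ , ap′ , cl′ , len′ =
    complete e F′ P′ hits′ ap′ cl′ (trans (cong (_+ e) len′) (trans (sym (+-suc _ e)) len))

  tiling⇒factor : ∀ T → AllPairs Disjoint T → All Clique T → length T ≡ n → KFactor G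
  tiling⇒factor T ap cl len = record
    { copy      = λ t r → r , lookup (List.lookup T (index t)) r
    ; injective = λ t r t′ r′ eq →
        index-injective (distinct T ap (index t) (index t′) r
          (trans (cong proj₂ eq) (cong (lookup (List.lookup T (index t′))) (sym (cong proj₁ eq))))) , cong proj₁ eq
    ; clique    = λ t r s r≢s → All.lookup cl (∈-lookup (index t)) r s r≢s
    }
    where
    index : Fin n → Fin (length T)
    index = Fin.cast (sym len)
    index-injective : ∀ {t t′} → index t ≡ index t′ → t ≡ t′
    index-injective {t} {t′} eq = Fin.toℕ-injective
      (trans (sym (Fin.toℕ-cast (sym len) t)) (trans (cong toℕ eq) (Fin.toℕ-cast (sym len) t′)))
    distinct : ∀ T → AllPairs Disjoint T → ∀ t t′ r → lookup (List.lookup T t) r ≡ lookup (List.lookup T t′) r → t ≡ t′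
    distinct (c ∷ T) (d ∷ ap) zero    zero     r eq = refl
    distinct (c ∷ T) (d ∷ ap) zero    (suc t′) r eq = ⊥-elim (All.lookup d (∈-lookup t′) r eq)
    distinct (c ∷ T) (d ∷ ap) (suc t) zero     r eq = ⊥-elim (All.lookup d (∈-lookup t) r (sym eq))
    distinct (c ∷ T) (d ∷ ap) (suc t) (suc t′) r eq = cong suc (distinct T ap t t′ r eq)

-- Assembling a factor

module _ {q n : ℕ} {{_ : NonZero q}} (G : BalancedPartiteGraph q n) where

  open Absorbers G
  open Absorption G

  -- First m absorbers are reserved, then the remaining r₀ vertices per class are tiled until ℓ are
  -- left, and these are absorbed. That takes q exchanges for each of ℓ transversals, hence ℓ * q
  -- hits per test.
  nearTiling⇒factor : ∀ {d t′ β B a ℓ m r₀} {{_ : NonZero a}} (let t = suc t′) (let E = suc (16 * q)) →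
    (∀ x j → j ≢ proj₁ x → nonNeighbours x j (allFin n) ≤ d) →
    0 < B → B + q * d + m ≤ n → n ≤ β * B → suc a ≡ 2 * β ^ q → m ≡ a * (2 * (ℓ * q)) →
    q * (n * n ^ q) < 2 ^ (ℓ * q) → q * (q * n) < 2 ^ t →
    0 < d → d ≤ r₀ → suc (8 * q) * d ≤ 8 * r₀ → ℓ ≡ q * E * (E * t) → ℓ ≤ r₀ → m + r₀ ≡ n →
    KFactor G
  nearTiling⇒factor {d} {t′} {β} {B} {a} {ℓ} {m} {r₀} few 0<B B-small B-large 1+a≡ m≡ tests-few K<2^t
    0<d d≤r₀ d-small ℓ≡ ℓ≤r₀ m+r₀≡n =
    let F , apF , clF , lenF , small = select τ 1+a≡ m ≤-refl
        hits = λ τ → Φ-small⇒covering {β ^ q} {s = ℓ * q} F 1+a≡ (trans lenF m≡) (≤-<-trans length-tests tests-few)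
                 (subst (λ m → (β ^ q) ^ m * Φ F ≤ a ^ m * length tests) (sym lenF) small) (∈-tests τ)
        open Extend F ℓ r₀ (q * (q * n) * fall d k) k≤ℓ sparse
        P , ap , cl , len = extend (r₀ ∸ ℓ) [] apF clF (trans (cong₂ _+_ lenF r₀≡) m+r₀≡n)
          (≤-trans (*-monoˡ-≤ (fall r₀ k) (Φ-bound F d (λ x j j≢ → ≤-trans (nonNeighbours-free F x j) (few x j j≢))))
                   (≤-reflexive (cong (λ r → q * (q * n) * fall d k * fall r k) (sym r₀≡))))
        perm = ++-comm P F
        T , apT , clT , lenT = complete ℓ F P hits (AllPairs-↭ perm ap) (All-resp-↭ perm cl)
          (trans (cong (_+ ℓ) (sym (↭-length perm))) len)
    in tiling⇒factor T apT clT lenT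
    where
    t = suc t′
    -- Chosen so that `suc κ` computes to E * t.
    κ = t′ + 16 * q * t
    open Selection {d} {m} {β} {B} few 0<B B-small B-large using (select)
    open Potential κ using (k; Φ-bound; module Extend)
    k≤ℓ : k ≤ ℓ
    k≤ℓ = ≤-trans (m≤n*m k (q * suc (16 * q)) {{m*n≢0 q _}}) (≤-reflexive (sym ℓ≡))
    0<n : 0 < n
    0<n = ≤-trans 0<B (≤-trans (m≤m+n B _) (≤-trans (m≤m+n _ m) B-small))
    τ : Test
    τ = fromℕ< (>-nonZero⁻¹ q) , fromℕ< 0<n , Vec.replicate q (fromℕ< 0<n)
    r₀≡ : r₀ ∸ ℓ + ℓ ≡ r₀
    r₀≡ = m∸n+n≡m ℓ≤r₀
    sparse : ∀ {v r} → ℓ ≤ r → fall v k * fall r₀ k ≤ q * (q * n) * fall d k * fall r k → q * v ≤ r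
    sparse ℓ≤r = moment-bound⇒sparse {t = t} K<2^t 0<d d≤r₀ (≤-trans k≤ℓ ℓ≤r₀) d-small
      (≤-trans (≤-trans (s≤s z≤n) k≤ℓ) ℓ≤r) (≤-trans (≤-reflexive (sym ℓ≡)) ℓ≤r)

-- Choice of the constants

module Parameters (q : ℕ) {{_ : NonZero q}} where

  -- n / β choices remain for each vertex of an absorber, so a test is met with probability β ^ - q.
  -- With t = n / W, the number of absorbing cliques is m = W t / β.
  D E β a s₁ W c n₀ : ℕ
  D  = suc (4 * q)
  E  = suc (16 * q)
  β  = 2 * D
  a  = pred (2 * β ^ q)
  -- The required number of hits is ℓ * q = s₁ * t, so that W * t = β * m.
  s₁ = q * E * E * q
  W  = β * (a * (2 * s₁))
  -- From n ≤ 2 * W * t follows q * (q * n) ≤ c * t; n₀ then makes t large enough for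
  -- `linear<exponential`.
  c  = q * (q * (2 * W))
  n₀ = suc (c + c) * W

  1+a≡ : suc a ≡ 2 * β ^ q
  1+a≡ = suc-pred (2 * β ^ q) {{m*n≢0 2 (β ^ q) {{_}} {{m^n≢0 β q}}}}

  instance
    a≢0 : NonZero a
    a≢0 = >-nonZero (≤-pred (≤-trans (*-monoʳ-≤ 2 (m^n>0 β q)) (≤-reflexive (sym 1+a≡))))
    s₁≢0 : NonZero s₁
    s₁≢0 = m*n≢0 (q * E * E) q {{m*n≢0 (q * E) E {{m*n≢0 q E}}}}
    W≢0 : NonZero W
    W≢0 = m*n≢0 β _ {{_}} {{m*n≢0 a _ {{a≢0}} {{m*n≢0 2 s₁}}}}

  module _ {n t : ℕ} (0<t : 0 < t) (Wt≤n : W * t ≤ n) (n≤2Wt : n ≤ 2 * W * t) (ct<2^t : c * t < 2 ^ t) where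

    open ≤-Reasoning

    ℓ m r₀ d choices : ℕ
    ℓ  = q * E * (E * t)
    m  = a * (2 * (ℓ * q))
    r₀ = n ∸ m
    d  = 4 * n / D
    choices = n ∸ (q * d + m)

    βm≤n : β * m ≤ n
    βm≤n = ≤-trans (≤-reflexive (e β a q E t)) Wt≤n
      where
      e : ∀ β a q E t → β * (a * (2 * (q * E * (E * t) * q))) ≡ β * (a * (2 * (q * E * E * q))) * t
      e = solve-∀

    m≤n : m ≤ n
    m≤n = ≤-trans (m≤n*m m β) βm≤n

    m+r₀≡n : m + r₀ ≡ n
    m+r₀≡n = m+[n∸m]≡n m≤n

    0<n : 0 < n
    0<n = ≤-trans (*-mono-≤ (>-nonZero⁻¹ W) 0<t) Wt≤n

    Dd≤4n : D * d ≤ 4 * n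
    Dd≤4n = ≤-trans (≤-reflexive (*-comm D d)) (m/n*n≤m (4 * n) D)

    ≤d : ∀ {x} → D * x ≤ 4 * n → x ≤ d
    ≤d {x} le = subst (_≤ d) (trans (/-congˡ {o = D} (*-comm D x)) (m*n/n≡m x D)) (/-monoˡ-≤ D le)

    0<d : 0 < d
    0<d = ≤d (begin
      D * 1        ≡⟨ *-identityʳ D ⟩
      D            ≤⟨ m≤n*m D 2 ⟩
      β            ≤⟨ m≤m*n β (a * (2 * s₁)) {{m*n≢0 a _ {{a≢0}} {{m*n≢0 2 s₁}}}} ⟩
      W            ≤⟨ m≤m*n W t {{>-nonZero 0<t}} ⟩
      W * t        ≤⟨ Wt≤n ⟩
      n            ≤⟨ m≤n*m n 4 ⟩
      4 * n        ∎)

    -- With β = 8q + 2, d is at most 8n/β, and r₀ ≥ n - n/β = (8q + 1) n/β.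
    d-small : suc (8 * q) * d ≤ 8 * r₀
    d-small = *-cancelˡ-≤ β (+-cancelʳ-≤ (8 * n) _ _ (begin
      β * (suc (8 * q) * d) + 8 * n          ≡⟨ e1 q d n ⟩
      2 * suc (8 * q) * (D * d) + 8 * n      ≤⟨ +-monoˡ-≤ (8 * n) (*-monoʳ-≤ (2 * suc (8 * q)) Dd≤4n) ⟩
      2 * suc (8 * q) * (4 * n) + 8 * n      ≡⟨ e2 q n ⟩
      8 * (β * n)                            ≡⟨ cong (λ z → 8 * (β * z)) m+r₀≡n ⟨
      8 * (β * (m + r₀))                     ≡⟨ e3 β m r₀ ⟩
      β * (8 * r₀) + 8 * (β * m)             ≤⟨ +-monoʳ-≤ (β * (8 * r₀)) (*-monoʳ-≤ 8 βm≤n) ⟩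
      β * (8 * r₀) + 8 * n                   ∎))
      where
      e1 : ∀ q d n → 2 * suc (4 * q) * (suc (8 * q) * d) + 8 * n ≡ 2 * suc (8 * q) * (suc (4 * q) * d) + 8 * n
      e1 = solve-∀
      e2 : ∀ q n → 2 * suc (8 * q) * (4 * n) + 8 * n ≡ 8 * (2 * suc (4 * q) * n)
      e2 = solve-∀
      e3 : ∀ β m r₀ → 8 * (β * (m + r₀)) ≡ β * (8 * r₀) + 8 * (β * m)
      e3 = solve-∀

    d≤r₀ : d ≤ r₀
    d≤r₀ = *-cancelˡ-≤ 8 (≤-trans (*-monoˡ-≤ d (m≤n⇒m≤1+n (m≤m*n 8 q))) d-small)

    ℓ≤r₀ : ℓ ≤ r₀
    ℓ≤r₀ = +-cancelˡ-≤ m _ _ (begin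
      m + ℓ       ≤⟨ +-monoʳ-≤ m (≤-trans (m≤m*n ℓ q) (≤-trans (m≤n*m (ℓ * q) 2) (m≤n*m (2 * (ℓ * q)) a))) ⟩
      m + m       ≡⟨ cong (m +_) (+-identityʳ m) ⟨
      2 * m       ≤⟨ *-monoˡ-≤ m (m≤m*n 2 D) ⟩
      β * m       ≤⟨ βm≤n ⟩
      n           ≡⟨ m+r₀≡n ⟨
      m + r₀      ∎)

    -- Since β = 8q + 2, this leaves at least n/β choices.
    used : β * (q * d + m) ≤ suc (8 * q) * n
    used = begin
      β * (q * d + m)                  ≡⟨ e1 q d m ⟩
      2 * q * (D * d) + β * m          ≤⟨ +-mono-≤ (*-monoʳ-≤ (2 * q) Dd≤4n) βm≤n ⟩
      2 * q * (4 * n) + n              ≡⟨ e2 q n ⟩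
      suc (8 * q) * n                  ∎
      where
      e1 : ∀ q d m → 2 * suc (4 * q) * (q * d + m) ≡ 2 * q * (suc (4 * q) * d) + 2 * suc (4 * q) * m
      e1 = solve-∀
      e2 : ∀ q n → 2 * q * (4 * n) + n ≡ suc (8 * q) * n
      e2 = solve-∀

    β≡ : β ≡ suc (suc (8 * q))
    β≡ = e q
      where
      e : ∀ q → 2 * suc (4 * q) ≡ suc (suc (8 * q))
      e = solve-∀

    used≤n : q * d + m ≤ n
    used≤n = *-cancelˡ-≤ β (≤-trans used (*-monoˡ-≤ n (≤-trans (n≤1+n _) (≤-reflexive (sym β≡)))))

    B≡ : choices + (q * d + m) ≡ n
    B≡ = m∸n+n≡m used≤n

    B-small : choices + q * d + m ≤ n
    B-small = ≤-reflexive (trans (+-assoc choices (q * d) m) B≡)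

    B-large : n ≤ β * choices
    B-large = +-cancelʳ-≤ (suc (8 * q) * n) _ _ (begin
      suc (suc (8 * q)) * n                   ≡⟨ cong (_* n) β≡ ⟨
      β * n                                   ≡⟨ cong (β *_) B≡ ⟨
      β * (choices + (q * d + m))                   ≡⟨ *-distribˡ-+ β choices _ ⟩
      β * choices + β * (q * d + m)                 ≤⟨ +-monoʳ-≤ (β * choices) used ⟩
      β * choices + suc (8 * q) * n                 ∎)

    0<B : 0 < choices
    0<B = >-nonZero⁻¹ choices {{m*n≢0⇒n≢0 β {{>-nonZero (≤-trans 0<n B-large)}}}}

    K<2^t : q * (q * n) < 2 ^ t
    K<2^t = ≤-<-trans (≤-trans (*-monoʳ-≤ q (*-monoʳ-≤ q n≤2Wt)) (≤-reflexive (e q (2 * W) t))) ct<2^t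
      where
      e : ∀ q w t → q * (q * (w * t)) ≡ q * (q * w) * t
      e = solve-∀

    qn≤ : q * n < 2 ^ t
    qn≤ = ≤-<-trans (m≤n*m (q * n) q) K<2^t

    -- Both q * n and n are below 2^t, so there are fewer than 2^(t + tq) tests, and ℓ * q is far
    -- larger than t + tq.
    tests-few : q * (n * n ^ q) < 2 ^ (ℓ * q)
    tests-few = begin-strict
      q * (n * n ^ q)       ≡⟨ *-assoc q n _ ⟨
      q * n * n ^ q         <⟨ *-monoˡ-< (n ^ q) {{m^n≢0 n q {{>-nonZero 0<n}}}} qn≤ ⟩
      2 ^ t * n ^ q         ≤⟨ *-monoʳ-≤ (2 ^ t) (^-monoˡ-≤ q (≤-trans (m≤n*m n q) (<⇒≤ qn≤))) ⟩
      2 ^ t * (2 ^ t) ^ q   ≡⟨ cong (2 ^ t *_) (^-*-assoc 2 t q) ⟩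
      2 ^ t * 2 ^ (t * q)   ≡⟨ ^-distribˡ-+-* 2 t (t * q) ⟨
      2 ^ (t + t * q)       ≤⟨ ^-monoʳ-≤ 2 exponents ⟩
      2 ^ (ℓ * q)           ∎
      where
      exponents : t + t * q ≤ ℓ * q
      exponents = begin
        t + t * q   ≡⟨ cong (t +_) (*-comm t q) ⟩
        t + q * t   ≤⟨ +-monoʳ-≤ t (*-monoˡ-≤ t (m≤n*m q 16)) ⟩
        E * t       ≤⟨ m≤n*m (E * t) (q * E) {{m*n≢0 q E}} ⟩
        ℓ           ≤⟨ m≤m*n ℓ q ⟩
        ℓ * q       ∎

  factor : ∀ n → n₀ < n → (G : BalancedPartiteGraph q n) →
    (∀ x j → j ≢ proj₁ x → D * Graph.nonNeighbours G x j (allFin n) ≤ 4 * n) → KFactor G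
  factor n n₀<n G few = conclude t t-large Wt≤n n≤2Wt
    where
    t = n / W
    open Graph G
    open ≤-Reasoning
    t-large : suc (c + c) ≤ t
    t-large = subst (_≤ t) (m*n/n≡m (suc (c + c)) W) (/-monoˡ-≤ W (<⇒≤ n₀<n))
    Wt≤n : W * t ≤ n
    Wt≤n = subst (_≤ n) (*-comm t W) (m/n*n≤m n W)
    n≤2Wt : n ≤ 2 * W * t
    n≤2Wt = begin
      n                   ≡⟨ m≡m%n+[m/n]*n n W ⟩
      n % W + t * W       ≤⟨ +-monoˡ-≤ (t * W) (≤-trans (<⇒≤ (m%n<n n W)) (m≤n*m W t {{>-nonZero (≤-trans (s≤s z≤n) t-large)}})) ⟩
      t * W + t * W       ≡⟨ e t W ⟩
      2 * W * t           ∎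
      where
      e : ∀ t w → t * w + t * w ≡ 2 * w * t
      e = solve-∀
    -- t is generalised from n / W so that it can be matched as a successor.
    conclude : ∀ t → suc (c + c) ≤ t → W * t ≤ n → n ≤ 2 * W * t → KFactor G
    conclude t@(suc t′) t-large Wt≤n n≤2Wt = nearTiling⇒factor G {t′ = t′}
      (λ x j j≢ → ≤d 0<t Wt≤n n≤2Wt ct (few x j j≢))
      (0<B 0<t Wt≤n n≤2Wt ct) (B-small 0<t Wt≤n n≤2Wt ct) (B-large 0<t Wt≤n n≤2Wt ct) 1+a≡ refl
      (tests-few 0<t Wt≤n n≤2Wt ct) (K<2^t 0<t Wt≤n n≤2Wt ct) (0<d 0<t Wt≤n n≤2Wt ct)
      (d≤r₀ 0<t Wt≤n n≤2Wt ct) (d-small 0<t Wt≤n n≤2Wt ct) refl (ℓ≤r₀ 0<t Wt≤n n≤2Wt ct) (m+r₀≡n 0<t Wt≤n n≤2Wt ct)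
      where
      0<t : 0 < t
      0<t = s≤s z≤n
      ct : c * t < 2 ^ t
      ct = linear<exponential c t t-large

-- The degree hypothesis

-- The map g gives the induction room to pass to `g ∘ suc`; it is used with the identity.
countTrue-complement : ∀ {m n} (f : Fin n → Bool) (g : Fin m → Fin n) →
  countTrue (f ∘ g) ℕ.+ ∑ (tabulate g) (λ a → ⟦ not (f a) ⟧) ≡ m
countTrue-complement {zero}  f g = refl
countTrue-complement {suc m} f g with f (g Fin.zero)
... | true  = cong suc (countTrue-complement f (g ∘ Fin.suc))
... | false = trans (ℕ.+-suc _ _) (cong suc (countTrue-complement f (g ∘ Fin.suc)))

toℚᵘ-/ : ∀ c m → toℚᵘ (⁺ c ℚ./ suc m) ℚᵘ.≃ mkℚᵘ (⁺ c) m
toℚᵘ-/ c m = ℚ.toℚᵘ-fromℚᵘ (mkℚᵘ (⁺ c) m)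

fractions-sum : ∀ {c d m} → c ℕ.+ d ≡ suc m → (⁺ c ℚ./ suc m) ℚ.+ (⁺ d ℚ./ suc m) ≡ 1ℚ
fractions-sum {c} {d} {m} eq = ℚ.toℚᵘ-injective (begin
  toℚᵘ ((⁺ c ℚ./ suc m) ℚ.+ (⁺ d ℚ./ suc m))          ≈⟨ ℚ.toℚᵘ-homo-+ (⁺ c ℚ./ suc m) (⁺ d ℚ./ suc m) ⟩
  toℚᵘ (⁺ c ℚ./ suc m) ℚᵘ.+ toℚᵘ (⁺ d ℚ./ suc m)      ≈⟨ ℚᵘ.+-cong (toℚᵘ-/ c m) (toℚᵘ-/ d m) ⟩
  mkℚᵘ (⁺ c) m ℚᵘ.+ mkℚᵘ (⁺ d) m                  ≈⟨ *≡* numerators ⟩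
  toℚᵘ 1ℚ                                         ∎)
  where
  open ℚᵘ.≃-Reasoning
  numerators : (⁺ c ℤ.* ⁺ suc m ℤ.+ ⁺ d ℤ.* ⁺ suc m) ℤ.* ⁺ 1 ≡ ⁺ 1 ℤ.* (⁺ suc m ℤ.* ⁺ suc m)
  numerators = trans (ℤ.*-identityʳ _) (trans (sym (ℤ.*-distribʳ-+ (⁺ suc m) (⁺ c) (⁺ d)))
    (trans (cong (λ z → ⁺ z ℤ.* ⁺ suc m) eq) (sym (ℤ.*-identityˡ _))))

harmonic-mono : ∀ m → harmonic m ℚ.≤ harmonic (suc m)
harmonic-mono m = subst (ℚ._≤ harmonic (suc m)) (ℚ.+-identityʳ (harmonic m))
  (ℚ.+-monoʳ-≤ (harmonic m) (ℚ.nonNegative⁻¹ (⁺ 1 ℚ./ suc m) {{ℚ.normalize-nonNeg 1 (suc m)}}))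

3/2≤harmonic : ∀ m → (⁺ 3 ℚ./ 2) ℚ.≤ harmonic (2 ℕ.+ m)
3/2≤harmonic zero    = ℚ.≤-refl
3/2≤harmonic (suc m) = ℚ.≤-trans (3/2≤harmonic m) (harmonic-mono (2 ℕ.+ m))

-- k_q + 1 = q - 1/2 + h_q/2, and h_q ≥ h_2 = 3/2.
q+1/4≤kq+1 : ∀ m → let q = 2 ℕ.+ m in (⁺ q ℚ./ 1) ℚ.+ (⁺ 1 ℚ./ 4) ℚ.≤ kq q ℚ.+ 1ℚ
q+1/4≤kq+1 m = begin
  -- The closed term -3/2 + (3/4 + 1) evaluates to 1/4.
  Q ℚ.+ (⁺ 1 ℚ./ 4)                                            ≡⟨ cong (Q ℚ.+_) refl ⟩
  Q ℚ.+ (ℚ.- (⁺ 3 ℚ./ 2) ℚ.+ ((⁺ 3 ℚ./ 2) ℚ.* (⁺ 1 ℚ./ 2) ℚ.+ 1ℚ))  ≡⟨ ℚ.+-assoc Q _ _ ⟨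
  (Q ℚ.- (⁺ 3 ℚ./ 2)) ℚ.+ ((⁺ 3 ℚ./ 2) ℚ.* (⁺ 1 ℚ./ 2) ℚ.+ 1ℚ)      ≡⟨ ℚ.+-assoc (Q ℚ.- (⁺ 3 ℚ./ 2)) _ _ ⟨
  (Q ℚ.- (⁺ 3 ℚ./ 2)) ℚ.+ (⁺ 3 ℚ./ 2) ℚ.* (⁺ 1 ℚ./ 2) ℚ.+ 1ℚ
    ≤⟨ ℚ.+-monoˡ-≤ 1ℚ (ℚ.+-monoʳ-≤ (Q ℚ.- (⁺ 3 ℚ./ 2)) (ℚ.*-monoʳ-≤-nonNeg (⁺ 1 ℚ./ 2) (3/2≤harmonic m))) ⟩
  kq (2 ℕ.+ m) ℚ.+ 1ℚ ∎
  where
  open ℚ.≤-Reasoning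
  Q = ⁺ (2 ℕ.+ m) ℚ./ 1

-- With σ = 1 - ρ, the degree condition k ≤ (k + 1) ρ becomes (k + 1) σ ≤ 1.
deficiency : ∀ {k x ρ σ} → x ℚ.≤ k ℚ.+ 1ℚ → ℚ.NonNegative σ → ρ ℚ.+ σ ≡ 1ℚ →
  k ℚ.≤ (k ℚ.+ 1ℚ) ℚ.* ρ → x ℚ.* σ ℚ.≤ 1ℚ
deficiency {k} {x} {ρ} {σ} x≤ σ≥0 ρ+σ≡1 k≤ = ℚ.≤-trans (ℚ.*-monoʳ-≤-nonNeg σ {{σ≥0}} x≤)
  (subst₂ ℚ._≤_ (cancel ((k ℚ.+ 1ℚ) ℚ.* σ)) (cancel 1ℚ) (ℚ.+-monoʳ-≤ (ℚ.- k) (begin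
  k ℚ.+ (k ℚ.+ 1ℚ) ℚ.* σ                         ≤⟨ ℚ.+-monoˡ-≤ ((k ℚ.+ 1ℚ) ℚ.* σ) k≤ ⟩
  (k ℚ.+ 1ℚ) ℚ.* ρ ℚ.+ (k ℚ.+ 1ℚ) ℚ.* σ          ≡⟨ ℚ.*-distribˡ-+ (k ℚ.+ 1ℚ) ρ σ ⟨
  (k ℚ.+ 1ℚ) ℚ.* (ρ ℚ.+ σ)                       ≡⟨ cong ((k ℚ.+ 1ℚ) ℚ.*_) ρ+σ≡1 ⟩
  (k ℚ.+ 1ℚ) ℚ.* 1ℚ                              ≡⟨ ℚ.*-identityʳ _ ⟩
  k ℚ.+ 1ℚ                                       ∎)))
  where
  open ℚ.≤-Reasoning
  cancel : ∀ y → ℚ.- k ℚ.+ (k ℚ.+ y) ≡ y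
  cancel y = trans (sym (ℚ.+-assoc (ℚ.- k) k y)) (trans (cong (ℚ._+ y) (ℚ.+-inverseˡ k)) (ℚ.+-identityˡ y))

-- Passing to unnormalised rationals exposes numerators and denominators, so the inequality can be
-- read off in the integers.
clear-denominators : ∀ q c m → ((⁺ q ℚ./ 1) ℚ.+ (⁺ 1 ℚ./ 4)) ℚ.* (⁺ c ℚ./ suc m) ℚ.≤ 1ℚ →
  suc (4 ℕ.* q) ℕ.* c ℕ.≤ 4 ℕ.* suc m
clear-denominators q c m le = integral (begin
  (mkℚᵘ (⁺ q) 0 ℚᵘ.+ mkℚᵘ (⁺ 1) 3) ℚᵘ.* mkℚᵘ (⁺ c) m
    ≃⟨ ℚᵘ.*-cong (ℚᵘ.+-cong (toℚᵘ-/ q 0) (ℚᵘ.≃-refl {mkℚᵘ (⁺ 1) 3})) (toℚᵘ-/ c m) ⟨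
  (toℚᵘ (⁺ q ℚ./ 1) ℚᵘ.+ toℚᵘ (⁺ 1 ℚ./ 4)) ℚᵘ.* toℚᵘ (⁺ c ℚ./ suc m)
    ≃⟨ ℚᵘ.*-cong (ℚ.toℚᵘ-homo-+ (⁺ q ℚ./ 1) (⁺ 1 ℚ./ 4)) (ℚᵘ.≃-refl {toℚᵘ (⁺ c ℚ./ suc m)}) ⟨
  toℚᵘ ((⁺ q ℚ./ 1) ℚ.+ (⁺ 1 ℚ./ 4)) ℚᵘ.* toℚᵘ (⁺ c ℚ./ suc m)
    ≃⟨ ℚ.toℚᵘ-homo-* ((⁺ q ℚ./ 1) ℚ.+ (⁺ 1 ℚ./ 4)) (⁺ c ℚ./ suc m) ⟨
  toℚᵘ (((⁺ q ℚ./ 1) ℚ.+ (⁺ 1 ℚ./ 4)) ℚ.* (⁺ c ℚ./ suc m))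
    ≤⟨ ℚ.toℚᵘ-mono-≤ le ⟩
  toℚᵘ 1ℚ ∎)
  where
  open ℚᵘ.≤-Reasoning
  integral : (mkℚᵘ (⁺ q) 0 ℚᵘ.+ mkℚᵘ (⁺ 1) 3) ℚᵘ.* mkℚᵘ (⁺ c) m ℚᵘ.≤ toℚᵘ 1ℚ →
    suc (4 ℕ.* q) ℕ.* c ℕ.≤ 4 ℕ.* suc m
  integral (*≤* p) = subst (ℕ._≤ 4 ℕ.* suc m) (commute q c) (ℤ.drop‿+≤+ (subst₂ ℤ._≤_ numerator (ℤ.*-identityˡ _) p))
    where
    numerator : (⁺ q ℤ.* ⁺ 4 ℤ.+ ⁺ 1) ℤ.* ⁺ c ℤ.* ⁺ 1 ≡ ⁺ ((q ℕ.* 4 ℕ.+ 1) ℕ.* c)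
    numerator = trans (ℤ.*-identityʳ _) (trans (cong (λ z → (z ℤ.+ ⁺ 1) ℤ.* ⁺ c) (sym (ℤ.pos-* q 4)))
      (sym (ℤ.pos-* (q ℕ.* 4 ℕ.+ 1) c)))
    commute : ∀ q c → (q ℕ.* 4 ℕ.+ 1) ℕ.* c ≡ suc (4 ℕ.* q) ℕ.* c
    commute = solve-∀

few-nonNeighbours : ∀ {q′ n} (let q = 2 ℕ.+ q′) (G : BalancedPartiteGraph q n) →
  PropMinDegAtLeast G (kq q) → ∀ x j → j ≢ proj₁ x →
  suc (4 ℕ.* q) ℕ.* Graph.nonNeighbours G x j (allFin n) ℕ.≤ 4 ℕ.* n
few-nonNeighbours {q′} {suc m} G minDeg x@(i , v) j j≢i = clear-denominators (2 ℕ.+ q′) c m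
  (deficiency (q+1/4≤kq+1 q′) (ℚ.normalize-nonNeg c (suc m))
    (fractions-sum {degTo G x j} {c} (countTrue-complement (λ a → adj G x (j , a)) id)) (minDeg i v j j≢i))
  where
  open Graph G
  c = nonNeighbours x j (allFin (suc m))

theorem3 : (q : ℕ) → q ≥ 3 →
    ∃[ n₀ ] ∀ (n : ℕ) → n₀ < n →
    (G : BalancedPartiteGraph q n) →
    PropMinDegAtLeast G (kq q) →
    KFactor G
theorem3 (suc zero) (s≤s ())
theorem3 q@(suc (suc _)) _ = n₀ , λ n n₀<n G minDeg → factor n n₀<n G (few-nonNeighbours G minDeg)
  where open Parameters q
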